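{- Let $S$ be a simple type, $\alpha\in\{0,1,2\}$ a modality, $M$ a term, $V$ a value, $A$ a type, $\Sigma_1,\Sigma_2,\Sigma'$ label contexts, and $C_1,C_2$ circuits (all of the language Proto-Quipper-C over given categories $\mathbf{M},\mathbf{R},\mathbf{N}$). Suppose $S\vdash_{\alpha}(C_1,\Sigma_1,M):A;\Sigma'$ is a well-typed configuration and $(C_1,\Sigma_1,M)\Downarrow(C_2,\Sigma_2,V)$. Then $S\vdash_{\alpha}(C_2,\Sigma_2,V):A;\Sigma'$ is a well-typed configuration.
   Context: **Circuit categories.** Fix three small categories. (i) $\mathbf{M}$ is a symmetric monoidal category. (ii) $\mathbf{R}$ is a reversible subcategory of $\mathbf{M}$: a dagger symmetric monoidal category with an identity-on-objects, faithful, symmetric strong monoidal functor $I:\mathbf{R}\to\mathbf{M}$. (iii) $\mathbf{N}$ is a controllable category of $\mathbf{R}$: a dagger symmetric monoidal category with the same objects as $\mathbf{R}$, with the following structure (where $f;g$ is composition in diagrammatic order). (a) For all $A,B$, a function $-\bullet-:\mathbf{R}(B,A)\times\mathbf{N}(A,A)\to\mathbf{N}(B,B)$ with $\mathrm{id}\bullet h=h$; $(g_1;g_2)\bullet h=g_1\bullet(g_2\bullet h)$; $(g_1\otimes g_2)\bullet(h_1\otimes h_2)=(g_1\bullet h_1)\otimes(g_2\bullet h_2)$; $(g\bullet h)^\dagger=g\bullet h^\dagger$. (b) A discrete monoidal category $\mathcal{C}$ of controls, with a monoidal functor $\mathcal{C}\to\mathbf{N}$, $K\mapsto\underline{K}$.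 (c) For all $A\in\mathbf{N}$, $K\in\mathcal{C}$, a function $\mathrm{ctrl}_K:\mathbf{N}(A,A)\to\mathbf{N}(\underline{K}\otimes A,\underline{K}\otimes A)$ such that $\mathrm{ctrl}_K(\mathrm{id}_A)=\mathrm{id}_{\underline{K}\otimes A}$ and, for $h\in\mathbf N(A,A)$ and controls $K,L$: $\mathrm{ctrl}_I(h)$ corresponds to $h$ under the canonical isomorphism $\underline{I}\otimes A\cong A$; $\mathrm{ctrl}_{K\otimes L}(h)$ corresponds to $\mathrm{ctrl}_K(\mathrm{ctrl}_L(h))$ under $\underline{K\otimes L}\otimes A\cong\underline{K}\otimes(\underline{L}\otimes A)$; $\mathrm{ctrl}_{K\otimes L}(h)$ corresponds to $\mathrm{ctrl}_{L\otimes K}(h)$ under the symmetry $\underline{K\otimes L}\otimes A\cong\underline{L\otimes K}\otimes A$. (d) An identity-on-objects, strict dagger symmetric monoidal functor $G:\mathbf{N}\to\mathbf{R}$ with $G(g\bullet h)=g;G(h);g^\dagger$. Write $\mathbf{D}^0=\mathbf{M}$, $\mathbf{D}^1=\mathbf{R}$, $\mathbf{D}^2=\mathbf{N}$. A circuit is a morphism of one of these categories (remembering which one). A morphism of $\mathbf{D}^\alpha$ and a morphism of $\mathbf{D}^\beta$ are composed or tensored in $\mathbf{D}^{\alpha\wedge\beta}$ after applying $G$ and/or $I$ as needed. **Syntax.** Modalities: $\alpha,\beta,\gamma\in\{0,1,2\}$, $0<1<2$, $\alpha\wedge\beta=\min(\alpha,\beta)$. $W$ ranges over wire types; each denotes an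 object $[\![W]\!]$ of $\mathbf{M}$. Types: $A,B::=\mathsf{Unit}\mid W\mid\mathsf{Bool}\mid{!}_\alpha A\mid A\multimap_\alpha B\mid\mathsf{Circ}_\alpha(S,U)\mid A\otimes B$. Parameter types: $P,R::=\mathsf{Unit}\mid\mathsf{Bool}\mid{!}_\alpha A\mid\mathsf{Circ}_\alpha(S,U)\mid P\otimes R$. Simple types: $S,U::=\mathsf{Unit}\mid W\mid S\otimes U$, with $[\![S]\!]$ the corresponding object ($[\![\mathsf{Unit}]\!]=I$). Each $\underline{K}$ is assumed to be a simple type. Terms: $M,N::=c\mid x\mid\ell\mid\mathsf{unit}\mid\lambda x.M\mid MN\mid(M,N)\mid\mathsf{let}\,(x,y)=N\,\mathsf{in}\,M\mid\mathsf{lift}\,M\mid\mathsf{force}\,M\mid\mathsf{circ}(S,C,U)\mid\mathsf{apply}(M,N)\mid\mathsf{box}_S\,M\mid\mathsf{reverse}\,M\mid\mathsf{controlled}_K\,M\mid\mathsf{withComputed}\,M\,N$. Here $x$ ranges over variables, $\ell$ over labels (distinct from variables, never substituted), $c$ over constants (e.g. $\mathsf{True},\mathsf{False}$ of type $\mathsf{Bool}$), $C$ over circuits $[\![S]\!]\to[\![U]\!]$ in $\mathbf{M}$, $\mathbf{R}$ or $\mathbf{N}$. Simple terms: $a,b::=\ell\mid\mathsf{unit}\mid(a,b)$. Values: $V::=c\mid x\mid\ell\mid\mathsf{unit}\mid\lambda x.M\mid(V,V')\mid\mathsf{lift}\,M\mid\mathsf{circ}(S,C,U)$. Contexts $\Gamma$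 are finite unordered lists of declarations $x:A$ and $\ell:W$ (distinct names). $\Phi$ denotes parameter contexts (only $x:P$, $P$ a parameter type), $\Sigma$ label contexts (only $\ell:W$). For $\Sigma=\ell_1:W_1,\ldots,\ell_n:W_n$, $[\![\Sigma]\!]=[\![W_1]\!]\otimes\cdots\otimes[\![W_n]\!]$ (reorderings via the symmetry). **Typing rules** (premises $\Rightarrow$ conclusion). - $\Phi,x:A\vdash_2 x:A$; $\ \Phi,\ell:W\vdash_2\ell:W$; $\ \Phi\vdash_2\mathsf{unit}:\mathsf{Unit}$; $\ \Phi\vdash_2 c:A_c$, where $A_c$ is the given type of $c$. - lambda: $\Gamma,x:A\vdash_\alpha M:B\Rightarrow\Gamma\vdash_2\lambda x.M:A\multimap_\alpha B$. - app: $\Phi,\Gamma_1\vdash_{\alpha_1}M:A\multimap_\beta B$ and $\Phi,\Gamma_2\vdash_{\alpha_2}N:A\Rightarrow\Phi,\Gamma_1,\Gamma_2\vdash_{\alpha_1\wedge\alpha_2\wedge\beta}MN:B$. - lift: $\Phi\vdash_\alpha M:A\Rightarrow\Phi\vdash_2\mathsf{lift}\,M:{!}_\alpha A$. - force: $\Gamma\vdash_\beta M:{!}_\alpha A\Rightarrow\Gamma\vdash_{\alpha\wedge\beta}\mathsf{force}\,M:A$. - pair: $\Phi,\Gamma_1\vdash_{\alpha_1}M:A$ and $\Phi,\Gamma_2\vdash_{\alpha_2}N:B\Rightarrow\Phi,\Gamma_1,\Gamma_2\vdash_{\alpha_1\wedge\alpha_2}(M,N):A\otimes B$. - let: $\Phi,\Gamma_1,x:A,y:B\vdash_{\alpha_1}M:C$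 and $\Phi,\Gamma_2\vdash_{\alpha_2}N:A\otimes B\Rightarrow\Phi,\Gamma_1,\Gamma_2\vdash_{\alpha_1\wedge\alpha_2}\mathsf{let}\,(x,y)=N\,\mathsf{in}\,M:C$. - circ: $C\in\mathbf{D}^\alpha([\![S]\!],[\![U]\!])\Rightarrow\Phi\vdash_2\mathsf{circ}(S,C,U):\mathsf{Circ}_\alpha(S,U)$. - apply: $\Phi,\Gamma_1\vdash_\alpha M:\mathsf{Circ}_\gamma(S,U)$ and $\Phi,\Gamma_2\vdash_\beta N:S\Rightarrow\Phi,\Gamma_1,\Gamma_2\vdash_{\alpha\wedge\beta\wedge\gamma}\mathsf{apply}(M,N):U$. - box: $\Gamma\vdash_\alpha M:{!}_\beta(S\multimap_\gamma U)\Rightarrow\Gamma\vdash_\alpha\mathsf{box}_S\,M:\mathsf{Circ}_{\beta\wedge\gamma}(S,U)$. - rev: $\Gamma\vdash_\alpha M:\mathsf{Circ}_\gamma(S,U)$, $\gamma>0\Rightarrow\Gamma\vdash_\alpha\mathsf{reverse}\,M:\mathsf{Circ}_\gamma(U,S)$. - ctrl: $\Gamma\vdash_\alpha M:\mathsf{Circ}_2(S,S)\Rightarrow\Gamma\vdash_\alpha\mathsf{controlled}_K\,M:\mathsf{Circ}_2(\underline{K}\otimes S,\underline{K}\otimes S)$. - wc: $\Phi,\Gamma_1\vdash_\alpha M:\mathsf{Circ}_\gamma(U,S)$, $\gamma>0$, and $\Phi,\Gamma_2\vdash_\beta N:\mathsf{Circ}_2(S,S)\Rightarrow\Phi,\Gamma_1,\Gamma_2\vdash_{\alpha\wedge\beta}\mathsf{withComputed}\,M\,N:\mathsf{Circ}_2(U,U)$.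 **Operational semantics.** A configuration is a triple $(C,\Sigma,M)$ with $M$ a term, $\Sigma$ a label context, and $C:X\to[\![\Sigma]\!]$ a morphism of $\mathbf{M}$, $\mathbf{R}$ or $\mathbf{N}$. For a simple term $a$ write $\Sigma\vdash a:S$ for $\Sigma\vdash_2a:S$; there is an evident structural isomorphism $[\![a]\!]:[\![\Sigma]\!]\to[\![S]\!]$ (with inverse $[\![a]\!]^\dagger$) in each of the three categories. $\mathrm{ungen}(a,\Sigma)$ is the unique $S$ with $\Sigma\vdash a:S$. $\mathrm{gen}(S)=(a,\Sigma)$ means a simple term $a$ with fresh labels and its label context $\Sigma$ are generated, so that $\Sigma\vdash a:S$. The relation $\Downarrow$ (evaluation to a value) is inductively defined by: - values: $(C,\Sigma,V)\Downarrow(C,\Sigma,V)$. - app: $(C_1,\Sigma_1,M)\Downarrow(C_2,\Sigma_2,\lambda x.M')$, $(C_2,\Sigma_2,N)\Downarrow(C_3,\Sigma_3,V)$, $(C_3,\Sigma_3,[V/x]M')\Downarrow(C_4,\Sigma_4,V')$ $\Rightarrow(C_1,\Sigma_1,MN)\Downarrow(C_4,\Sigma_4,V')$. - force: $(C,\Sigma,M)\Downarrow(C',\Sigma',\mathsf{lift}\,M')$, $(C',\Sigma',M')\Downarrow(C'',\Sigma'',V)$ $\Rightarrow(C,\Sigma,\mathsf{force}\,M)\Downarrow(C'',\Sigma'',V)$. - let: $(C,\Sigma,N)\Downarrow(C',\Sigma',(V_1,V_2))$, $(C',\Sigma',[V_1/x,V_2/y]M)\Downarrow(C'',\Sigma'',V)$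 $\Rightarrow(C,\Sigma,\mathsf{let}\,(x,y)=N\,\mathsf{in}\,M)\Downarrow(C'',\Sigma'',V)$. - pair: $(C,\Sigma,M)\Downarrow(C',\Sigma',V_1)$, $(C',\Sigma',N)\Downarrow(C'',\Sigma'',V_2)$ $\Rightarrow(C,\Sigma,(M,N))\Downarrow(C'',\Sigma'',(V_1,V_2))$. - box: $(C,\Sigma,M)\Downarrow(C',\Sigma',\mathsf{lift}\,M')$, $\mathrm{gen}(S)=(a,\Sigma'')$, $([\![a]\!]^\dagger,\Sigma'',M'\,a)\Downarrow(D,\Sigma''',b)$ with $[\![a]\!]^\dagger$ taken in $\mathbf{N}$, $\mathrm{ungen}(b,\Sigma''')=U$ $\Rightarrow(C,\Sigma,\mathsf{box}_S\,M)\Downarrow(C',\Sigma',\mathsf{circ}(S,[\![b]\!]\circ D,U))$. - apply: $(C_1,\Sigma_1,M)\Downarrow(C_2,\Sigma_2,\mathsf{circ}(S,D,U))$, $(C_2,\Sigma_2,N)\Downarrow(C_3,\Sigma_3,a)$, $\mathrm{gen}(U)=(b,\Sigma)$, $(C',\Sigma')=\mathrm{append}(C_3,\Sigma_3,a,D,b,\Sigma)$ $\Rightarrow(C_1,\Sigma_1,\mathsf{apply}(M,N))\Downarrow(C',\Sigma',b)$. Here, with $\Sigma_3'$ the unique label context such that $\Sigma_3'\vdash a:S$ and $\Sigma_3=\Sigma_3',\Sigma_3''$ (runtime error, i.e. no evaluation, if impossible), $\Sigma'=\Sigma,\Sigma_3''$ and $C'$ is the composite $X\xrightarrow{C_3}[\![\Sigma_3]\!]\cong[\![\Sigma_3']\!]\otimes[\![\Sigma_3'']\!]\xrightarrow{([\![b]\!]^\dagger\circ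 D\circ[\![a]\!])\otimes\mathrm{id}}[\![\Sigma]\!]\otimes[\![\Sigma_3'']\!]\cong[\![\Sigma']\!]$. - rev: $(C,\Sigma,M)\Downarrow(C',\Sigma',\mathsf{circ}(S,D,U))$ $\Rightarrow(C,\Sigma,\mathsf{reverse}\,M)\Downarrow(C',\Sigma',\mathsf{circ}(U,D^\dagger,S))$, provided $D$ is in $\mathbf{R}$ or $\mathbf{N}$ ($D^\dagger$ taken in that category). - ctrl: $(C,\Sigma,M)\Downarrow(C',\Sigma',\mathsf{circ}(S,D,U))$ $\Rightarrow(C,\Sigma,\mathsf{controlled}_K\,M)\Downarrow(C',\Sigma',\mathsf{circ}(\underline{K}\otimes S,\mathrm{ctrl}_KD,\underline{K}\otimes S))$, provided $D$ is in $\mathbf{N}$ (and $U=S$). - wc: $(C,\Sigma,N)\Downarrow(C',\Sigma',\mathsf{circ}(U,D_2,U))$, $(C',\Sigma',M)\Downarrow(C'',\Sigma'',\mathsf{circ}(S,D_1,U))$ $\Rightarrow(C,\Sigma,\mathsf{withComputed}\,M\,N)\Downarrow(C'',\Sigma'',\mathsf{circ}(S,D_1\bullet D_2,S))$, provided $D_2\in\mathbf{N}$ and $D_1\in\mathbf{R}$ or $D_1\in\mathbf{N}$ (in the latter case $G(D_1)$ is used in place of $D_1$). **Well-typed configuration.** $S\vdash_\alpha(C,\Sigma,M):A;\Sigma'$ means: there exist $\beta,\gamma,\Sigma''$ such that $C\in\mathbf{D}^\beta([\![S]\!],[\![\Sigma]\!])$, $\Sigma=(\Sigma'',\Sigma')$,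 $\Sigma''\vdash_\gamma M:A$ and $\alpha=\beta\wedge\gamma$. -}

module Defs where

open import Algebra.Structures using (IsMonoid)
open import Data.Fin using (Fin; zero; suc)
open import Data.List using (List; []; _∷_; _++_; map)
open import Data.List.Relation.Binary.Disjoint.Propositional using (Disjoint)
open import Data.List.Relation.Binary.Permutation.Propositional using (_↭_; refl; prep; swap; trans; ↭-sym)
open import Data.List.Relation.Unary.Unique.Propositional using (Unique)
open import Data.Maybe using (Maybe; just; nothing)
import Data.Maybe.Relation.Unary.All as Maybe
open import Data.Nat using (ℕ; suc)
open import Data.Product using (Σ-syntax; ∃-syntax; _×_; _,_; proj₁; proj₂)
open import Data.Vec using (Vec; []; _∷_; replicate)
open import Data.Vec.Relation.Unary.All using (All)
open import Level using (Level; _⊔_) renaming (suc to lsuc)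
open import Relation.Binary.PropositionalEquality using (_≡_; subst; sym) renaming (refl to ≡-refl)
open import Relation.Binary.Structures using (IsEquivalence)

private
  variable
    u : Level

-- The object type is a parameter, so that "identity on objects" is expressed
-- by sharing it. Equality of morphisms is a setoid equality.
record Category (Obj : Set u) : Set (lsuc u) where
  infix  4 _≈_
  infixr 9 _∘_
  field
    Hom     : Obj → Obj → Set u
    _≈_     : ∀ {A B} → Hom A B → Hom A B → Set u
    ≈-equiv : ∀ {A B} → IsEquivalence (_≈_ {A} {B})
    id      : ∀ {A} → Hom A A
    _∘_     : ∀ {A B C} → Hom B C → Hom A B → Hom A C
    ∘-resp  : ∀ {A B C} {f f′ : Hom B C} {g g′ : Hom A B} → f ≈ f′ → g ≈ g′ → f ∘ g ≈ f′ ∘ g′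
    idˡ     : ∀ {A B} {f : Hom A B} → id ∘ f ≈ f
    idʳ     : ∀ {A B} {f : Hom A B} → f ∘ id ≈ f
    assoc   : ∀ {A B C D} {f : Hom A B} {g : Hom B C} {h : Hom C D} → (h ∘ g) ∘ f ≈ h ∘ (g ∘ f)

  Inverse : ∀ {A B} → Hom A B → Hom B A → Set u
  Inverse f g = (g ∘ f ≈ id) × (f ∘ g ≈ id)

-- The object part of the monoidal structure is a parameter, so that strictness
-- on objects is expressed by sharing it.
record SymmetricMonoidal {Obj : Set u} (𝐂 : Category Obj)
                         (_⊗₀_ : Obj → Obj → Obj) (I : Obj) : Set u where
  open Category 𝐂
  infixr 10 _⊗_
  field
    _⊗_    : ∀ {A B C D} → Hom A B → Hom C D → Hom (A ⊗₀ C) (B ⊗₀ D)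
    ⊗-resp : ∀ {A B C D} {f f′ : Hom A B} {g g′ : Hom C D} → f ≈ f′ → g ≈ g′ → f ⊗ g ≈ f′ ⊗ g′
    ⊗-id   : ∀ {A B} → id {A} ⊗ id {B} ≈ id
    ⊗-∘    : ∀ {A B C A′ B′ C′} {f : Hom A B} {g : Hom B C} {f′ : Hom A′ B′} {g′ : Hom B′ C′} →
             (g ∘ f) ⊗ (g′ ∘ f′) ≈ (g ⊗ g′) ∘ (f ⊗ f′)

    α⇒ : ∀ {A B C} → Hom ((A ⊗₀ B) ⊗₀ C) (A ⊗₀ (B ⊗₀ C))
    α⇐ : ∀ {A B C} → Hom (A ⊗₀ (B ⊗₀ C)) ((A ⊗₀ B) ⊗₀ C)
    λ⇒ : ∀ {A} → Hom (I ⊗₀ A) A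
    λ⇐ : ∀ {A} → Hom A (I ⊗₀ A)
    ρ⇒ : ∀ {A} → Hom (A ⊗₀ I) A
    ρ⇐ : ∀ {A} → Hom A (A ⊗₀ I)
    σ  : ∀ {A B} → Hom (A ⊗₀ B) (B ⊗₀ A)

    α-iso : ∀ {A B C} → Inverse (α⇒ {A} {B} {C}) α⇐
    λ-iso : ∀ {A} → Inverse (λ⇒ {A}) λ⇐
    ρ-iso : ∀ {A} → Inverse (ρ⇒ {A}) ρ⇐
    σ-iso : ∀ {A B} → σ {B} {A} ∘ σ {A} {B} ≈ id

    α-nat : ∀ {A B C A′ B′ C′} {f : Hom A A′} {g : Hom B B′} {h : Hom C C′} →
            α⇒ ∘ ((f ⊗ g) ⊗ h) ≈ (f ⊗ (g ⊗ h)) ∘ α⇒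
    λ-nat : ∀ {A B} {f : Hom A B} → λ⇒ ∘ (id ⊗ f) ≈ f ∘ λ⇒
    ρ-nat : ∀ {A B} {f : Hom A B} → ρ⇒ ∘ (f ⊗ id) ≈ f ∘ ρ⇒
    σ-nat : ∀ {A B A′ B′} {f : Hom A A′} {g : Hom B B′} → σ ∘ (f ⊗ g) ≈ (g ⊗ f) ∘ σ

    triangle : ∀ {A B} → (id {A} ⊗ λ⇒ {B}) ∘ α⇒ ≈ ρ⇒ ⊗ id
    pentagon : ∀ {A B C D} →
               (id {A} ⊗ α⇒ {B} {C} {D}) ∘ (α⇒ ∘ (α⇒ ⊗ id)) ≈ α⇒ ∘ α⇒
    hexagon  : ∀ {A B C} →
               (id {B} ⊗ σ {A} {C}) ∘ (α⇒ ∘ (σ ⊗ id)) ≈ α⇒ ∘ (σ ∘ α⇒)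

record DaggerMonoidal {Obj : Set u} {𝐂 : Category Obj} {_⊗₀_ : Obj → Obj → Obj} {I : Obj}
                      (𝐂⊗ : SymmetricMonoidal 𝐂 _⊗₀_ I) : Set u where
  open Category 𝐂
  open SymmetricMonoidal 𝐂⊗
  infix 11 _†
  field
    _†           : ∀ {A B} → Hom A B → Hom B A
    †-resp       : ∀ {A B} {f g : Hom A B} → f ≈ g → f † ≈ g †
    †-involutive : ∀ {A B} {f : Hom A B} → f † † ≈ f
    †-id         : ∀ {A} → id {A} † ≈ id
    †-∘          : ∀ {A B C} {f : Hom A B} {g : Hom B C} → (g ∘ f) † ≈ f † ∘ g †
    †-⊗          : ∀ {A B C D} {f : Hom A B} {g : Hom C D} → (f ⊗ g) † ≈ f † ⊗ g †
    †-α          : ∀ {A B C} → α⇒ {A} {B} {C} † ≈ α⇐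
    †-λ          : ∀ {A} → λ⇒ {A} † ≈ λ⇐
    †-ρ          : ∀ {A} → ρ⇒ {A} † ≈ ρ⇐
    †-σ          : ∀ {A B} → σ {A} {B} † ≈ σ

module SMC {Obj : Set u} {𝐂 : Category Obj} {_⊗₀_ : Obj → Obj → Obj} {I : Obj}
           (𝐂⊗ : SymmetricMonoidal 𝐂 _⊗₀_ I) where
  open Category 𝐂 public
  open SymmetricMonoidal 𝐂⊗ public

module DaggerSMC {Obj : Set u} {𝐂 : Category Obj} {_⊗₀_ : Obj → Obj → Obj} {I : Obj}
                 {𝐂⊗ : SymmetricMonoidal 𝐂 _⊗₀_ I} (𝐂† : DaggerMonoidal 𝐂⊗) where
  open SMC 𝐂⊗ public
  open DaggerMonoidal 𝐂† public

record IdentityOnObjectsFunctor {Obj : Set u} (𝐂 𝐃 : Category Obj) : Set u where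
  private
    module C = Category 𝐂
    module D = Category 𝐃
  field
    F₁     : ∀ {A B} → C.Hom A B → D.Hom A B
    F-resp : ∀ {A B} {f g : C.Hom A B} → f C.≈ g → F₁ f D.≈ F₁ g
    F-id   : ∀ {A} → F₁ (C.id {A}) D.≈ D.id
    F-∘    : ∀ {A B C} {f : C.Hom A B} {g : C.Hom B C} → F₁ (g C.∘ f) D.≈ F₁ g D.∘ F₁ f

-- Identity on objects does not make the tensor products of objects agree, so
-- the comparison isomorphisms φ and ε relate two tensors on the same objects.
record SymmetricStrongMonoidal {Obj : Set u} {𝐂 𝐃 : Category Obj}
         {_⊗ᶜ_ _⊗ᵈ_ : Obj → Obj → Obj} {Iᶜ Iᵈ : Obj}
         (𝐂⊗ : SymmetricMonoidal 𝐂 _⊗ᶜ_ Iᶜ) (𝐃⊗ : SymmetricMonoidal 𝐃 _⊗ᵈ_ Iᵈ)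
         (F : IdentityOnObjectsFunctor 𝐂 𝐃) : Set u where
  private
    module C = SMC 𝐂⊗
  open SMC 𝐃⊗
  open IdentityOnObjectsFunctor F
  field
    ε⇒ : Hom Iᵈ Iᶜ
    ε⇐ : Hom Iᶜ Iᵈ
    φ⇒ : ∀ {A B} → Hom (A ⊗ᵈ B) (A ⊗ᶜ B)
    φ⇐ : ∀ {A B} → Hom (A ⊗ᶜ B) (A ⊗ᵈ B)
    ε-iso : Inverse ε⇒ ε⇐
    φ-iso : ∀ {A B} → Inverse (φ⇒ {A} {B}) φ⇐
    φ-nat : ∀ {A B A′ B′} {f : C.Hom A A′} {g : C.Hom B B′} →
            φ⇒ ∘ (F₁ f ⊗ F₁ g) ≈ F₁ (f C.⊗ g) ∘ φ⇒
    φ-α : ∀ {A B C} → F₁ C.α⇒ ∘ (φ⇒ ∘ (φ⇒ {A} {B} ⊗ id {C})) ≈ φ⇒ ∘ ((id ⊗ φ⇒) ∘ α⇒)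
    φ-λ : ∀ {A} → F₁ C.λ⇒ ∘ (φ⇒ ∘ (ε⇒ ⊗ id {A})) ≈ λ⇒
    φ-ρ : ∀ {A} → F₁ C.ρ⇒ ∘ (φ⇒ ∘ (id {A} ⊗ ε⇒)) ≈ ρ⇒
    φ-σ : ∀ {A B} → F₁ (C.σ {A} {B}) ∘ φ⇒ ≈ φ⇒ ∘ σ

record StrictDaggerSymmetricMonoidal {Obj : Set u} {𝐂 𝐃 : Category Obj}
         {_⊗₀_ : Obj → Obj → Obj} {I : Obj}
         {𝐂⊗ : SymmetricMonoidal 𝐂 _⊗₀_ I} {𝐃⊗ : SymmetricMonoidal 𝐃 _⊗₀_ I}
         (𝐂† : DaggerMonoidal 𝐂⊗) (𝐃† : DaggerMonoidal 𝐃⊗)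
         (F : IdentityOnObjectsFunctor 𝐂 𝐃) : Set u where
  private
    module C = DaggerSMC 𝐂†
  open DaggerSMC 𝐃†
  open IdentityOnObjectsFunctor F
  field
    F-⊗ : ∀ {A B A′ B′} {f : C.Hom A A′} {g : C.Hom B B′} → F₁ (f C.⊗ g) ≈ F₁ f ⊗ F₁ g
    F-α : ∀ {A B C} → F₁ (C.α⇒ {A} {B} {C}) ≈ α⇒
    F-λ : ∀ {A} → F₁ (C.λ⇒ {A}) ≈ λ⇒
    F-ρ : ∀ {A} → F₁ (C.ρ⇒ {A}) ≈ ρ⇒
    F-σ : ∀ {A B} → F₁ (C.σ {A} {B}) ≈ σ
    F-† : ∀ {A B} {f : C.Hom A B} → F₁ (f C.†) ≈ F₁ f †

record ReversibleSubcategory {Obj : Set u} {𝐌 : Category Obj}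
         {_⊗ᴹ_ : Obj → Obj → Obj} {Iᴹ : Obj} (𝐌⊗ : SymmetricMonoidal 𝐌 _⊗ᴹ_ Iᴹ)
         : Set (lsuc u) where
  field
    𝐑    : Category Obj
    _⊗ᴿ_ : Obj → Obj → Obj
    Iᴿ   : Obj
    𝐑⊗   : SymmetricMonoidal 𝐑 _⊗ᴿ_ Iᴿ
    𝐑†   : DaggerMonoidal 𝐑⊗
    𝐈    : IdentityOnObjectsFunctor 𝐑 𝐌
    𝐈⊗   : SymmetricStrongMonoidal 𝐑⊗ 𝐌⊗ 𝐈

  private
    module M = Category 𝐌
    module R = Category 𝐑
  open IdentityOnObjectsFunctor 𝐈

  field
    𝐈-faithful : ∀ {A B} {f g : R.Hom A B} → F₁ f M.≈ F₁ g → f R.≈ g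

-- A discrete monoidal category is a monoid: its coherence isomorphisms are
-- identities, i.e. equalities between objects.
record Controls {Obj : Set u} {𝐍 : Category Obj} {_⊗₀_ : Obj → Obj → Obj} {I : Obj}
                (𝐍⊗ : SymmetricMonoidal 𝐍 _⊗₀_ I) : Set (lsuc u) where
  open SMC 𝐍⊗
  infixr 8 _·_
  field
    Control  : Set u
    _·_      : Control → Control → Control
    𝟙        : Control
    isMonoid : IsMonoid _≡_ _·_ 𝟙
    ⌊_⌋      : Control → Obj
    ε⇒ : Hom I ⌊ 𝟙 ⌋
    ε⇐ : Hom ⌊ 𝟙 ⌋ I
    μ⇒ : ∀ {K L} → Hom (⌊ K ⌋ ⊗₀ ⌊ L ⌋) ⌊ K · L ⌋
    μ⇐ : ∀ {K L} → Hom ⌊ K · L ⌋ (⌊ K ⌋ ⊗₀ ⌊ L ⌋)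
    ε-iso : Inverse ε⇒ ε⇐
    μ-iso : ∀ {K L} → Inverse (μ⇒ {K} {L}) μ⇐

  private
    module 𝒞 = IsMonoid isMonoid

  ⌊⌋-map : ∀ {K L} → K ≡ L → Hom ⌊ K ⌋ ⌊ L ⌋
  ⌊⌋-map {K} eq = subst (λ L → Hom ⌊ K ⌋ ⌊ L ⌋) eq id

  field
    μ-α : ∀ {K L J} → ⌊⌋-map (𝒞.assoc K L J) ∘ (μ⇒ ∘ (μ⇒ ⊗ id)) ≈ μ⇒ ∘ ((id ⊗ μ⇒) ∘ α⇒)
    μ-λ : ∀ {K} → ⌊⌋-map (𝒞.identityˡ K) ∘ (μ⇒ ∘ (ε⇒ ⊗ id)) ≈ λ⇒
    μ-ρ : ∀ {K} → ⌊⌋-map (𝒞.identityʳ K) ∘ (μ⇒ ∘ (id ⊗ ε⇒)) ≈ ρ⇒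

-- Since 𝐆 is strict and the identity on objects, 𝐍 has the same tensor
-- products of objects as 𝐑.
record ControllableCategory {Obj : Set u} {𝐑 : Category Obj}
         {_⊗₀_ : Obj → Obj → Obj} {I : Obj}
         {𝐑⊗ : SymmetricMonoidal 𝐑 _⊗₀_ I} (𝐑† : DaggerMonoidal 𝐑⊗) : Set (lsuc u) where
  field
    𝐍        : Category Obj
    𝐍⊗       : SymmetricMonoidal 𝐍 _⊗₀_ I
    𝐍†       : DaggerMonoidal 𝐍⊗
    controls : Controls 𝐍⊗
    𝐆        : IdentityOnObjectsFunctor 𝐍 𝐑
    𝐆⊗†      : StrictDaggerSymmetricMonoidal 𝐍† 𝐑† 𝐆

  private
    module R = DaggerSMC 𝐑†
  open DaggerSMC 𝐍†
  open Controls controls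
  open IdentityOnObjectsFunctor 𝐆

  infixr 12 _•_
  field
    _•_    : ∀ {A B} → R.Hom B A → Hom A A → Hom B B
    •-resp : ∀ {A B} {g g′ : R.Hom B A} {h h′ : Hom A A} → g R.≈ g′ → h ≈ h′ → g • h ≈ g′ • h′
    •-id   : ∀ {A} {h : Hom A A} → R.id • h ≈ h
    •-∘    : ∀ {A B C} {g₁ : R.Hom C B} {g₂ : R.Hom B A} {h : Hom A A} →
             (g₂ R.∘ g₁) • h ≈ g₁ • (g₂ • h)
    •-⊗    : ∀ {A₁ B₁ A₂ B₂} {g₁ : R.Hom B₁ A₁} {g₂ : R.Hom B₂ A₂} {h₁ : Hom A₁ A₁} {h₂ : Hom A₂ A₂} →
             (g₁ R.⊗ g₂) • (h₁ ⊗ h₂) ≈ (g₁ • h₁) ⊗ (g₂ • h₂)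
    •-†    : ∀ {A B} {g : R.Hom B A} {h : Hom A A} → (g • h) † ≈ g • (h †)

    ctrl      : ∀ {A} (K : Control) → Hom A A → Hom (⌊ K ⌋ ⊗₀ A) (⌊ K ⌋ ⊗₀ A)
    ctrl-resp : ∀ {A K} {h h′ : Hom A A} → h ≈ h′ → ctrl K h ≈ ctrl K h′
    ctrl-id   : ∀ {A K} → ctrl K (id {A}) ≈ id
    ctrl-𝟙    : ∀ {A} {h : Hom A A} →
                (λ⇒ ∘ (ε⇐ ⊗ id)) ∘ ctrl 𝟙 h ≈ h ∘ (λ⇒ ∘ (ε⇐ ⊗ id))
    ctrl-·    : ∀ {A K L} {h : Hom A A} →
                (α⇒ ∘ (μ⇐ ⊗ id)) ∘ ctrl (K · L) h ≈ ctrl K (ctrl L h) ∘ (α⇒ ∘ (μ⇐ ⊗ id))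
    ctrl-σ    : ∀ {A K L} {h : Hom A A} →
                ((μ⇒ ∘ (σ ∘ μ⇐)) ⊗ id) ∘ ctrl (K · L) h ≈
                ctrl (L · K) h ∘ ((μ⇒ ∘ (σ ∘ μ⇐)) ⊗ id)

    𝐆-• : ∀ {A B} {g : R.Hom B A} {h : Hom A A} → F₁ (g • h) R.≈ g R.† R.∘ (F₁ h R.∘ g)

record CircuitCategories (u : Level) : Set (lsuc u) where
  field
    Obj          : Set u
    𝐌            : Category Obj
    _⊗ᴹ_         : Obj → Obj → Obj
    Iᴹ           : Obj
    𝐌⊗           : SymmetricMonoidal 𝐌 _⊗ᴹ_ Iᴹ
    reversible   : ReversibleSubcategory 𝐌⊗
  open ReversibleSubcategory reversible public
  field
    controllable : ControllableCategory 𝐑†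
  open ControllableCategory controllable public
  open Controls controls public using (Control; ⌊_⌋)

data Modality : Set where
  𝟎 𝟏 𝟐 : Modality

infixr 7 _∧_

_∧_ : Modality → Modality → Modality
𝟎 ∧ β = 𝟎
𝟏 ∧ 𝟎 = 𝟎
𝟏 ∧ 𝟏 = 𝟏
𝟏 ∧ 𝟐 = 𝟏
𝟐 ∧ β = β

data _>𝟎 : Modality → Set where
  𝟏>𝟎 : 𝟏 >𝟎
  𝟐>𝟎 : 𝟐 >𝟎

infixr 8 _⊗_

data SimpleTy (Wire : Set u) : Set u where
  unit : SimpleTy Wire
  wire : Wire → SimpleTy Wire
  _⊗_  : SimpleTy Wire → SimpleTy Wire → SimpleTy Wire

data Ty (Wire : Set u) : Set u where
  unit      : Ty Wire
  wire      : Wire → Ty Wire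
  bool      : Ty Wire
  !_,_      : Modality → Ty Wire → Ty Wire
  _⊸[_]_    : Ty Wire → Modality → Ty Wire → Ty Wire
  Circ      : Modality → SimpleTy Wire → SimpleTy Wire → Ty Wire
  _⊗_       : Ty Wire → Ty Wire → Ty Wire

data Parameter {Wire : Set u} : Ty Wire → Set u where
  unit : Parameter unit
  bool : Parameter bool
  !_,_ : ∀ α A → Parameter (! α , A)
  Circ : ∀ α S U → Parameter (Circ α S U)
  _⊗_  : ∀ {P R} → Parameter P → Parameter R → Parameter (P ⊗ R)

⌜_⌝ : {Wire : Set u} → SimpleTy Wire → Ty Wire
⌜ unit ⌝   = unit
⌜ wire W ⌝ = wire W
⌜ S ⊗ U ⌝  = ⌜ S ⌝ ⊗ ⌜ U ⌝

Interpret : {Obj Wire : Set u} → (Obj → Obj → Obj) → Obj → (Wire → Obj) → SimpleTy Wire → Obj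
Interpret _⊗₀_ I ⟦_⟧ʷ unit     = I
Interpret _⊗₀_ I ⟦_⟧ʷ (wire W) = ⟦ W ⟧ʷ
Interpret _⊗₀_ I ⟦_⟧ʷ (S ⊗ U)  = Interpret _⊗₀_ I ⟦_⟧ʷ S ⊗₀ Interpret _⊗₀_ I ⟦_⟧ʷ U

-- The parameters of the language other than the circuit categories. The last
-- two fields express that the object ⌊ K ⌋ of every control K is (denoted by)
-- a simple type.
record Signature (𝒦 : CircuitCategories u) : Set (lsuc u) where
  open CircuitCategories 𝒦
  field
    Wire         : Set u
    ⟦_⟧ʷ         : Wire → Obj
    Const        : Set u
    constTy      : Const → Ty Wire
    controlTy    : Control → SimpleTy Wire
    controlTy-⌊⌋ : ∀ K → Interpret _⊗ᴿ_ Iᴿ ⟦_⟧ʷ (controlTy K) ≡ ⌊ K ⌋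

Label : Set
Label = ℕ

data STm : Set where
  lab  : Label → STm
  unit : STm
  pair : STm → STm → STm

module Language {u : Level} {𝒦 : CircuitCategories u} (𝒮 : Signature 𝒦) where

  open CircuitCategories 𝒦
  open Signature 𝒮

  Simple : Set u
  Simple = SimpleTy Wire

  Type : Set u
  Type = Ty Wire

  𝐃 : Modality → Category Obj
  𝐃 𝟎 = 𝐌
  𝐃 𝟏 = 𝐑
  𝐃 𝟐 = 𝐍

  tensor : Modality → Obj → Obj → Obj
  tensor 𝟎 = _⊗ᴹ_
  tensor 𝟏 = _⊗ᴿ_
  tensor 𝟐 = _⊗ᴿ_

  tensorUnit : Modality → Obj
  tensorUnit 𝟎 = Iᴹ
  tensorUnit 𝟏 = Iᴿ
  tensorUnit 𝟐 = Iᴿ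

  𝐃⊗ : ∀ α → SymmetricMonoidal (𝐃 α) (tensor α) (tensorUnit α)
  𝐃⊗ 𝟎 = 𝐌⊗
  𝐃⊗ 𝟏 = 𝐑⊗
  𝐃⊗ 𝟐 = 𝐍⊗

  private
    module D (α : Modality) = SMC (𝐃⊗ α)
    module M = SMC 𝐌⊗
    module I = IdentityOnObjectsFunctor 𝐈
    module G = IdentityOnObjectsFunctor 𝐆
    module R† = DaggerMonoidal 𝐑†
    module N† = DaggerMonoidal 𝐍†

  -- The object denoted by a simple type, formed with the tensor of 𝐃 α. As 𝐈
  -- is only strong monoidal, ⟦ S ⟧ 𝟎 and ⟦ S ⟧ 𝟏 may differ; the canonical
  -- isomorphism between them is κ below.
  ⟦_⟧ : Simple → Modality → Obj
  ⟦ S ⟧ α = Interpret (tensor α) (tensorUnit α) ⟦_⟧ʷ S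

  record Mor (α : Modality) (S U : Simple) : Set u where
    constructor mor
    field
      arrow : D.Hom α (⟦ S ⟧ α) (⟦ U ⟧ α)

  Circuit : Simple → Simple → Set u
  Circuit S U = Σ[ α ∈ Modality ] Mor α S U

  _∈𝐃_ : ∀ {S U} → Circuit S U → Modality → Set
  C ∈𝐃 α = proj₁ C ≡ α

  infixr 9  _∘_
  infixr 10 _⊗ᵐ_

  idᵐ : ∀ {α S} → Mor α S S
  idᵐ {α} = mor (D.id α)

  _∘_ : ∀ {α S T U} → Mor α T U → Mor α S T → Mor α S U
  _∘_ {α} (mor g) (mor f) = mor (D._∘_ α g f)

  _⊗ᵐ_ : ∀ {α S T S′ T′} → Mor α S T → Mor α S′ T′ → Mor α (S ⊗ S′) (T ⊗ T′)
  _⊗ᵐ_ {α} (mor f) (mor g) = mor (D._⊗_ α f g)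

  assoc⇒ : ∀ {α S T U} → Mor α ((S ⊗ T) ⊗ U) (S ⊗ (T ⊗ U))
  assoc⇒ {α} = mor (D.α⇒ α)

  assoc⇐ : ∀ {α S T U} → Mor α (S ⊗ (T ⊗ U)) ((S ⊗ T) ⊗ U)
  assoc⇐ {α} = mor (D.α⇐ α)

  unitˡ⇒ : ∀ {α S} → Mor α (unit ⊗ S) S
  unitˡ⇒ {α} = mor (D.λ⇒ α)

  unitˡ⇐ : ∀ {α S} → Mor α S (unit ⊗ S)
  unitˡ⇐ {α} = mor (D.λ⇐ α)

  unitʳ⇒ : ∀ {α S} → Mor α (S ⊗ unit) S
  unitʳ⇒ {α} = mor (D.ρ⇒ α)

  unitʳ⇐ : ∀ {α S} → Mor α S (S ⊗ unit)
  unitʳ⇐ {α} = mor (D.ρ⇐ α)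

  braid : ∀ {α S T} → Mor α (S ⊗ T) (T ⊗ S)
  braid {α} = mor (D.σ α)

  open SymmetricStrongMonoidal 𝐈⊗

  κ⇒ : ∀ S → M.Hom (⟦ S ⟧ 𝟎) (⟦ S ⟧ 𝟏)
  κ⇒ unit     = ε⇒
  κ⇒ (wire W) = M.id
  κ⇒ (S ⊗ U)  = φ⇒ M.∘ (κ⇒ S M.⊗ κ⇒ U)

  κ⇐ : ∀ S → M.Hom (⟦ S ⟧ 𝟏) (⟦ S ⟧ 𝟎)
  κ⇐ unit     = ε⇐
  κ⇐ (wire W) = M.id
  κ⇐ (S ⊗ U)  = (κ⇐ S M.⊗ κ⇐ U) M.∘ φ⇐

  applyI : ∀ {S U} → Mor 𝟏 S U → Mor 𝟎 S U
  applyI {S} {U} (mor f) = mor (κ⇐ U M.∘ (I.F₁ f M.∘ κ⇒ S))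

  applyG : ∀ {S U} → Mor 𝟐 S U → Mor 𝟏 S U
  applyG (mor f) = mor (G.F₁ f)

  lowerˡ : ∀ {α} β {S U} → Mor α S U → Mor (α ∧ β) S U
  lowerˡ {𝟎} β f = f
  lowerˡ {𝟏} 𝟎 f = applyI f
  lowerˡ {𝟏} 𝟏 f = f
  lowerˡ {𝟏} 𝟐 f = f
  lowerˡ {𝟐} 𝟎 f = applyI (applyG f)
  lowerˡ {𝟐} 𝟏 f = applyG f
  lowerˡ {𝟐} 𝟐 f = f

  lowerʳ : ∀ α {β S U} → Mor β S U → Mor (α ∧ β) S U
  lowerʳ 𝟎 {𝟎} f = f
  lowerʳ 𝟎 {𝟏} f = applyI f
  lowerʳ 𝟎 {𝟐} f = applyI (applyG f)
  lowerʳ 𝟏 {𝟎} f = f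
  lowerʳ 𝟏 {𝟏} f = f
  lowerʳ 𝟏 {𝟐} f = applyG f
  lowerʳ 𝟐     f = f

  dagger : ∀ {γ S U} → γ >𝟎 → Mor γ S U → Mor γ U S
  dagger 𝟏>𝟎 (mor f) = mor (f R†.†)
  dagger 𝟐>𝟎 (mor f) = mor (f N†.†)

  toR : ∀ {γ S U} → γ >𝟎 → Mor γ S U → Mor 𝟏 S U
  toR 𝟏>𝟎 f = f
  toR 𝟐>𝟎 f = applyG f

  conjugate : ∀ {S U} → Mor 𝟏 S U → Mor 𝟐 U U → Mor 𝟐 S S
  conjugate (mor g) (mor h) = mor (g • h)

  controlledMor : ∀ {S} K → Mor 𝟐 S S → Mor 𝟐 (controlTy K ⊗ S) (controlTy K ⊗ S)
  controlledMor {S} K (mor h) =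
    mor (subst (λ X → D.Hom 𝟐 (X ⊗ᴿ ⟦ S ⟧ 𝟐) (X ⊗ᴿ ⟦ S ⟧ 𝟐)) (sym (controlTy-⌊⌋ K)) (ctrl K h))

  -- Lists considered up to permutation; distinctness of the labels is imposed
  -- by Distinct where contexts are formed.
  LabelCtx : Set u
  LabelCtx = List (Label × Wire)

  labels : LabelCtx → List Label
  labels = map proj₁

  Distinct : LabelCtx → Set
  Distinct Σ = Unique (labels Σ)

  -- The simple type denoting ⟦Σ⟧, i.e. ⟦W₁⟧ ⊗ (⟦W₂⟧ ⊗ (… ⊗ I))
  ⟨_⟩ : LabelCtx → Simple
  ⟨ [] ⟩          = unit
  ⟨ (_ , W) ∷ Σ ⟩ = wire W ⊗ ⟨ Σ ⟩

  -- For distinct labels, coherence makes this independent of the derivation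
  -- of the permutation.
  permute : ∀ {α} {Σ Θ} → Σ ↭ Θ → Mor α ⟨ Σ ⟩ ⟨ Θ ⟩
  permute refl         = idᵐ
  permute (prep _ p)   = idᵐ ⊗ᵐ permute p
  permute (swap _ _ p) = assoc⇒ ∘ ((braid ⊗ᵐ permute p) ∘ assoc⇐)
  permute (trans p q)  = permute q ∘ permute p

  split⇒ : ∀ {α} Σ {Θ} → Mor α ⟨ Σ ++ Θ ⟩ (⟨ Σ ⟩ ⊗ ⟨ Θ ⟩)
  split⇒ []      = unitˡ⇐
  split⇒ (_ ∷ Σ) = assoc⇐ ∘ (idᵐ ⊗ᵐ split⇒ Σ)

  split⇐ : ∀ {α} Σ {Θ} → Mor α (⟨ Σ ⟩ ⊗ ⟨ Θ ⟩) ⟨ Σ ++ Θ ⟩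
  split⇐ []      = unitˡ⇒
  split⇐ (_ ∷ Σ) = (idᵐ ⊗ᵐ split⇐ Σ) ∘ assoc⇒

  -- Variables are de Bruijn indices; labels are names.
  data Tm (n : ℕ) : Set u where
    const        : Const → Tm n
    var          : Fin n → Tm n
    lab          : Label → Tm n
    unit         : Tm n
    ƛ_           : Tm (suc n) → Tm n
    _·_          : Tm n → Tm n → Tm n
    pair         : Tm n → Tm n → Tm n
    -- let (x , y) = N in M, where y is index 0 and x is index 1 in M
    letpair      : (N : Tm n) (M : Tm (suc (suc n))) → Tm n
    lift         : Tm n → Tm n
    force        : Tm n → Tm n
    circ         : (S U : Simple) → Circuit S U → Tm n
    apply        : Tm n → Tm n → Tm n
    box          : Simple → Tm n → Tm n
    reverse      : Tm n → Tm n
    controlled   : Control → Tm n → Tm n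
    withComputed : Tm n → Tm n → Tm n

  infixl 9 _·_
  infix  8 ƛ_

  ⌞_⌟ : ∀ {n} → STm → Tm n
  ⌞ lab ℓ ⌟    = lab ℓ
  ⌞ unit ⌟     = unit
  ⌞ pair a b ⌟ = pair ⌞ a ⌟ ⌞ b ⌟

  data Value {n : ℕ} : Tm n → Set u where
    const : ∀ c → Value (const c)
    var   : ∀ x → Value (var x)
    lab   : ∀ ℓ → Value (lab ℓ)
    unit  : Value unit
    ƛ_    : ∀ M → Value (ƛ M)
    pair  : ∀ {V V′} → Value V → Value V′ → Value (pair V V′)
    lift  : ∀ M → Value (lift M)
    circ  : ∀ S U C → Value (circ S U C)

  liftRen : ∀ {m n} → (Fin m → Fin n) → Fin (suc m) → Fin (suc n)
  liftRen ρ zero    = zero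
  liftRen ρ (suc x) = suc (ρ x)

  rename : ∀ {m n} → (Fin m → Fin n) → Tm m → Tm n
  rename ρ (const c)          = const c
  rename ρ (var x)            = var (ρ x)
  rename ρ (lab ℓ)            = lab ℓ
  rename ρ unit               = unit
  rename ρ (ƛ M)              = ƛ rename (liftRen ρ) M
  rename ρ (M · N)            = rename ρ M · rename ρ N
  rename ρ (pair M N)         = pair (rename ρ M) (rename ρ N)
  rename ρ (letpair N M)      = letpair (rename ρ N) (rename (liftRen (liftRen ρ)) M)
  rename ρ (lift M)           = lift (rename ρ M)
  rename ρ (force M)          = force (rename ρ M)
  rename ρ (circ S U C)       = circ S U C
  rename ρ (apply M N)        = apply (rename ρ M) (rename ρ N)
  rename ρ (box S M)          = box S (rename ρ M)
  rename ρ (reverse M)        = reverse (rename ρ M)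
  rename ρ (controlled K M)   = controlled K (rename ρ M)
  rename ρ (withComputed M N) = withComputed (rename ρ M) (rename ρ N)

  liftSub : ∀ {m n} → (Fin m → Tm n) → Fin (suc m) → Tm (suc n)
  liftSub s zero    = var zero
  liftSub s (suc x) = rename suc (s x)

  substitute : ∀ {m n} → (Fin m → Tm n) → Tm m → Tm n
  substitute s (const c)          = const c
  substitute s (var x)            = s x
  substitute s (lab ℓ)            = lab ℓ
  substitute s unit               = unit
  substitute s (ƛ M)              = ƛ substitute (liftSub s) M
  substitute s (M · N)            = substitute s M · substitute s N
  substitute s (pair M N)         = pair (substitute s M) (substitute s N)
  substitute s (letpair N M)      = letpair (substitute s N) (substitute (liftSub (liftSub s)) M)
  substitute s (lift M)           = lift (substitute s M)
  substitute s (force M)          = force (substitute s M)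
  substitute s (circ S U C)       = circ S U C
  substitute s (apply M N)        = apply (substitute s M) (substitute s N)
  substitute s (box S M)          = box S (substitute s M)
  substitute s (reverse M)        = reverse (substitute s M)
  substitute s (controlled K M)   = controlled K (substitute s M)
  substitute s (withComputed M N) = withComputed (substitute s M) (substitute s N)

  _[_] : ∀ {n} → Tm (suc n) → Tm n → Tm n
  _[_] {n} M V = substitute s M
    where
    s : Fin (suc n) → Tm n
    s zero    = V
    s (suc x) = var x

  -- [V₁/x, V₂/y] M for the binders of letpair
  _[_∥_] : ∀ {n} → Tm (suc (suc n)) → Tm n → Tm n → Tm n
  _[_∥_] {n} M V₁ V₂ = substitute s M
    where
    s : Fin (suc (suc n)) → Tm n
    s zero          = V₂
    s (suc zero)    = V₁
    s (suc (suc x)) = var x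

  -- A context Γ is a pair of a variable part Δ and a label part Σ. Variables
  -- of the scope that are not declared in Γ are marked by nothing.
  VarCtx : ℕ → Set u
  VarCtx n = Vec (Maybe Type) n

  ∅ : ∀ {n} → VarCtx n
  ∅ {n} = replicate n nothing

  ParameterCtx : ∀ {n} → VarCtx n → Set u
  ParameterCtx = All (Maybe.All Parameter)

  -- Δ is the variable part of Φ , x : A with Φ a parameter context
  data _∋_∶_ : ∀ {n} → VarCtx n → Fin n → Type → Set u where
    here  : ∀ {n A} {Φ : VarCtx n} → ParameterCtx Φ → (just A ∷ Φ) ∋ zero ∶ A
    there : ∀ {n A D} {Δ : VarCtx n} {x} → Maybe.All Parameter D → Δ ∋ x ∶ A → (D ∷ Δ) ∋ suc x ∶ A

  -- Δ ≔ Δ₁ ⋈ Δ₂ when, for some Φ, Γ₁, Γ₂ (Φ a parameter context), Δ, Δ₁, Δ₂ are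
  -- the variable parts of Φ , Γ₁ , Γ₂ and Φ , Γ₁ and Φ , Γ₂.
  infix 4 _≔_⋈_
  data _≔_⋈_ : ∀ {n} → VarCtx n → VarCtx n → VarCtx n → Set u where
    []     : [] ≔ [] ⋈ []
    absent : ∀ {n} {Δ Δ₁ Δ₂ : VarCtx n} → Δ ≔ Δ₁ ⋈ Δ₂ →
             nothing ∷ Δ ≔ nothing ∷ Δ₁ ⋈ nothing ∷ Δ₂
    left   : ∀ {n A} {Δ Δ₁ Δ₂ : VarCtx n} → Δ ≔ Δ₁ ⋈ Δ₂ →
             just A ∷ Δ ≔ just A ∷ Δ₁ ⋈ nothing ∷ Δ₂
    right  : ∀ {n A} {Δ Δ₁ Δ₂ : VarCtx n} → Δ ≔ Δ₁ ⋈ Δ₂ →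
             just A ∷ Δ ≔ nothing ∷ Δ₁ ⋈ just A ∷ Δ₂
    both   : ∀ {n P} {Δ Δ₁ Δ₂ : VarCtx n} → Parameter P → Δ ≔ Δ₁ ⋈ Δ₂ →
             just P ∷ Δ ≔ just P ∷ Δ₁ ⋈ just P ∷ Δ₂

  infix 3 _∣_⊢[_]_∶_

  data _∣_⊢[_]_∶_ : ∀ {n} → VarCtx n → LabelCtx → Modality → Tm n → Type → Set u where

    var : ∀ {n} {Δ : VarCtx n} {x A} →
      Δ ∋ x ∶ A →
      Δ ∣ [] ⊢[ 𝟐 ] var x ∶ A

    lab : ∀ {n} {Φ : VarCtx n} {ℓ W} →
      ParameterCtx Φ →
      Φ ∣ (ℓ , W) ∷ [] ⊢[ 𝟐 ] lab ℓ ∶ wire W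

    unit : ∀ {n} {Φ : VarCtx n} →
      ParameterCtx Φ →
      Φ ∣ [] ⊢[ 𝟐 ] unit ∶ unit

    const : ∀ {n} {Φ : VarCtx n} {c} →
      ParameterCtx Φ →
      Φ ∣ [] ⊢[ 𝟐 ] const c ∶ constTy c

    lam : ∀ {n} {Δ : VarCtx n} {Σ α M A B} →
      just A ∷ Δ ∣ Σ ⊢[ α ] M ∶ B →
      Δ ∣ Σ ⊢[ 𝟐 ] ƛ M ∶ A ⊸[ α ] B

    app : ∀ {n} {Δ Δ₁ Δ₂ : VarCtx n} {Σ Σ₁ Σ₂ α₁ α₂ β M N A B} →
      Δ ≔ Δ₁ ⋈ Δ₂ → Σ ↭ Σ₁ ++ Σ₂ →
      Δ₁ ∣ Σ₁ ⊢[ α₁ ] M ∶ A ⊸[ β ] B →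
      Δ₂ ∣ Σ₂ ⊢[ α₂ ] N ∶ A →
      Δ ∣ Σ ⊢[ α₁ ∧ α₂ ∧ β ] M · N ∶ B

    lift : ∀ {n} {Φ : VarCtx n} {α M A} →
      ParameterCtx Φ →
      Φ ∣ [] ⊢[ α ] M ∶ A →
      Φ ∣ [] ⊢[ 𝟐 ] lift M ∶ ! α , A

    force : ∀ {n} {Δ : VarCtx n} {Σ α β M A} →
      Δ ∣ Σ ⊢[ β ] M ∶ ! α , A →
      Δ ∣ Σ ⊢[ α ∧ β ] force M ∶ A

    pair : ∀ {n} {Δ Δ₁ Δ₂ : VarCtx n} {Σ Σ₁ Σ₂ α₁ α₂ M N A B} →
      Δ ≔ Δ₁ ⋈ Δ₂ → Σ ↭ Σ₁ ++ Σ₂ →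
      Δ₁ ∣ Σ₁ ⊢[ α₁ ] M ∶ A →
      Δ₂ ∣ Σ₂ ⊢[ α₂ ] N ∶ B →
      Δ ∣ Σ ⊢[ α₁ ∧ α₂ ] pair M N ∶ A ⊗ B

    letpair : ∀ {n} {Δ Δ₁ Δ₂ : VarCtx n} {Σ Σ₁ Σ₂ α₁ α₂ M N A B C} →
      Δ ≔ Δ₁ ⋈ Δ₂ → Σ ↭ Σ₁ ++ Σ₂ →
      just B ∷ just A ∷ Δ₁ ∣ Σ₁ ⊢[ α₁ ] M ∶ C →
      Δ₂ ∣ Σ₂ ⊢[ α₂ ] N ∶ A ⊗ B →
      Δ ∣ Σ ⊢[ α₁ ∧ α₂ ] letpair N M ∶ C

    circ : ∀ {n} {Φ : VarCtx n} {α S U} {C : Circuit S U} →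
      ParameterCtx Φ →
      C ∈𝐃 α →
      Φ ∣ [] ⊢[ 𝟐 ] circ S U C ∶ Circ α S U

    apply : ∀ {n} {Δ Δ₁ Δ₂ : VarCtx n} {Σ Σ₁ Σ₂ α β γ M N S U} →
      Δ ≔ Δ₁ ⋈ Δ₂ → Σ ↭ Σ₁ ++ Σ₂ →
      Δ₁ ∣ Σ₁ ⊢[ α ] M ∶ Circ γ S U →
      Δ₂ ∣ Σ₂ ⊢[ β ] N ∶ ⌜ S ⌝ →
      Δ ∣ Σ ⊢[ α ∧ β ∧ γ ] apply M N ∶ ⌜ U ⌝

    box : ∀ {n} {Δ : VarCtx n} {Σ α β γ M S U} →
      Δ ∣ Σ ⊢[ α ] M ∶ ! β , (⌜ S ⌝ ⊸[ γ ] ⌜ U ⌝) →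
      Δ ∣ Σ ⊢[ α ] box S M ∶ Circ (β ∧ γ) S U

    reverse : ∀ {n} {Δ : VarCtx n} {Σ α γ M S U} →
      Δ ∣ Σ ⊢[ α ] M ∶ Circ γ S U →
      γ >𝟎 →
      Δ ∣ Σ ⊢[ α ] reverse M ∶ Circ γ U S

    controlled : ∀ {n} {Δ : VarCtx n} {Σ α M S K} →
      Δ ∣ Σ ⊢[ α ] M ∶ Circ 𝟐 S S →
      Δ ∣ Σ ⊢[ α ] controlled K M ∶ Circ 𝟐 (controlTy K ⊗ S) (controlTy K ⊗ S)

    withComputed : ∀ {n} {Δ Δ₁ Δ₂ : VarCtx n} {Σ Σ₁ Σ₂ α β γ M N S U} →
      Δ ≔ Δ₁ ⋈ Δ₂ → Σ ↭ Σ₁ ++ Σ₂ →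
      Δ₁ ∣ Σ₁ ⊢[ α ] M ∶ Circ γ U S →
      γ >𝟎 →
      Δ₂ ∣ Σ₂ ⊢[ β ] N ∶ Circ 𝟐 S S →
      Δ ∣ Σ ⊢[ α ∧ β ] withComputed M N ∶ Circ 𝟐 U U

  infix 3 _⊢ˢ_∶_
  _⊢ˢ_∶_ : LabelCtx → STm → Simple → Set u
  Σ ⊢ˢ a ∶ S = [] ∣ Σ ⊢[ 𝟐 ] ⌞ a ⌟ ∶ ⌜ S ⌝

  -- The structural isomorphism ⟦a⟧ : ⟦Σ⟧ → ⟦S⟧ in 𝐃 α and its inverse ⟦a⟧†.
  -- The typing is stated with arbitrary β and Δ only so that the pair case can
  -- be matched; they are always 𝟐 and [].
  structural⇒ : ∀ {α β Σ n} {Δ : VarCtx n} a S → Δ ∣ Σ ⊢[ β ] ⌞ a ⌟ ∶ ⌜ S ⌝ → Mor α ⟨ Σ ⟩ S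
  structural⇒ (lab ℓ)    (wire W) (lab _)  = unitʳ⇒
  structural⇒ unit       unit     (unit _) = idᵐ
  structural⇒ (pair a b) (S ⊗ U)  (pair {Σ₁ = Σ₁} _ p d e) =
    (structural⇒ a S d ⊗ᵐ structural⇒ b U e) ∘ split⇒ Σ₁ ∘ permute p

  structural⇐ : ∀ {α β Σ n} {Δ : VarCtx n} a S → Δ ∣ Σ ⊢[ β ] ⌞ a ⌟ ∶ ⌜ S ⌝ → Mor α S ⟨ Σ ⟩
  structural⇐ (lab ℓ)    (wire W) (lab _)  = unitʳ⇐
  structural⇐ unit       unit     (unit _) = idᵐ
  structural⇐ (pair a b) (S ⊗ U)  (pair {Σ₁ = Σ₁} _ p d e) =
    permute (↭-sym p) ∘ split⇐ Σ₁ ∘ (structural⇐ a S d ⊗ᵐ structural⇐ b U e)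

  -- (a , Σ) is a possible result of gen(S) when the labels of Θ are in use.
  -- Labels consumed earlier in an evaluation may be generated again; a stricter
  -- notion of freshness yields a smaller evaluation relation.
  record Gen (Θ : LabelCtx) (S : Simple) (a : STm) (Σ : LabelCtx) : Set u where
    field
      typing   : Σ ⊢ˢ a ∶ S
      distinct : Distinct Σ
      fresh    : Disjoint (labels Σ) (labels Θ)

  -- ⟦X⟧ → ⟦Σ₃⟧ ≅ ⟦Σ₃′⟧ ⊗ ⟦Σ₃″⟧ → ⟦Σ⟧ ⊗ ⟦Σ₃″⟧ ≅ ⟦Σ , Σ₃″⟧
  append : ∀ {X S U a b Σ₃ Σ₃′ Σ₃″ Σ} → Circuit X ⟨ Σ₃ ⟩ → Σ₃ ↭ Σ₃′ ++ Σ₃″ →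
           Σ₃′ ⊢ˢ a ∶ S → Circuit S U → Σ ⊢ˢ b ∶ U → Circuit X ⟨ Σ ++ Σ₃″ ⟩
  append {S = S} {U} {a} {b} {Σ₃′ = Σ₃′} {Σ = Σ} (β , C₃) p d (γ , D) e =
    β ∧ γ ,
    split⇐ Σ ∘
    ((structural⇐ b U e ∘ lowerʳ β D ∘ structural⇒ a S d) ⊗ᵐ idᵐ) ∘
    split⇒ Σ₃′ ∘
    permute p ∘
    lowerˡ γ C₃

  -- The configuration (C , Σ , M) is written ⟪ C , Σ , M ⟫, with C a circuit
  -- ⟦X⟧ → ⟦Σ⟧. The domain is a simple type because its denotation depends on
  -- the category C is in, and this category may change during evaluation.
  record Config (X : Simple) (n : ℕ) : Set u where
    constructor config
    field
      labelCtx : LabelCtx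
      circuit  : Circuit X ⟨ labelCtx ⟩
      term     : Tm n

  pattern ⟪_,_,_⟫ C Σ M = config Σ C M

  infix 3 _⇓_

  data _⇓_ {n : ℕ} : ∀ {X} → Config X n → Config X n → Set u where

    value : ∀ {X Σ V} {C : Circuit X ⟨ Σ ⟩} →
      Value V →
      ⟪ C , Σ , V ⟫ ⇓ ⟪ C , Σ , V ⟫

    app : ∀ {X Σ₁ Σ₂ Σ₃ Σ₄ M M′ N V V′}
      {C₁ : Circuit X ⟨ Σ₁ ⟩} {C₂ : Circuit X ⟨ Σ₂ ⟩} {C₃ : Circuit X ⟨ Σ₃ ⟩} {C₄ : Circuit X ⟨ Σ₄ ⟩} →
      ⟪ C₁ , Σ₁ , M ⟫ ⇓ ⟪ C₂ , Σ₂ , ƛ M′ ⟫ →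
      ⟪ C₂ , Σ₂ , N ⟫ ⇓ ⟪ C₃ , Σ₃ , V ⟫ →
      ⟪ C₃ , Σ₃ , M′ [ V ] ⟫ ⇓ ⟪ C₄ , Σ₄ , V′ ⟫ →
      ⟪ C₁ , Σ₁ , M · N ⟫ ⇓ ⟪ C₄ , Σ₄ , V′ ⟫

    force : ∀ {X Σ Σ′ Σ″ M M′ V}
      {C : Circuit X ⟨ Σ ⟩} {C′ : Circuit X ⟨ Σ′ ⟩} {C″ : Circuit X ⟨ Σ″ ⟩} →
      ⟪ C , Σ , M ⟫ ⇓ ⟪ C′ , Σ′ , lift M′ ⟫ →
      ⟪ C′ , Σ′ , M′ ⟫ ⇓ ⟪ C″ , Σ″ , V ⟫ →
      ⟪ C , Σ , force M ⟫ ⇓ ⟪ C″ , Σ″ , V ⟫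

    letpair : ∀ {X Σ Σ′ Σ″ N M V₁ V₂ V}
      {C : Circuit X ⟨ Σ ⟩} {C′ : Circuit X ⟨ Σ′ ⟩} {C″ : Circuit X ⟨ Σ″ ⟩} →
      ⟪ C , Σ , N ⟫ ⇓ ⟪ C′ , Σ′ , pair V₁ V₂ ⟫ →
      ⟪ C′ , Σ′ , M [ V₁ ∥ V₂ ] ⟫ ⇓ ⟪ C″ , Σ″ , V ⟫ →
      ⟪ C , Σ , letpair N M ⟫ ⇓ ⟪ C″ , Σ″ , V ⟫

    pair : ∀ {X Σ Σ′ Σ″ M N V₁ V₂}
      {C : Circuit X ⟨ Σ ⟩} {C′ : Circuit X ⟨ Σ′ ⟩} {C″ : Circuit X ⟨ Σ″ ⟩} →
      ⟪ C , Σ , M ⟫ ⇓ ⟪ C′ , Σ′ , V₁ ⟫ →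
      ⟪ C′ , Σ′ , N ⟫ ⇓ ⟪ C″ , Σ″ , V₂ ⟫ →
      ⟪ C , Σ , pair M N ⟫ ⇓ ⟪ C″ , Σ″ , pair V₁ V₂ ⟫

    box : ∀ {X S U Σ Σ′ Σ″ Σ‴ M M′ a b δ} {D : Mor δ S ⟨ Σ‴ ⟩}
      {C : Circuit X ⟨ Σ ⟩} {C′ : Circuit X ⟨ Σ′ ⟩} →
      ⟪ C , Σ , M ⟫ ⇓ ⟪ C′ , Σ′ , lift M′ ⟫ →
      (g : Gen Σ′ S a Σ″) →
      ⟪ (𝟐 , structural⇐ a S (Gen.typing g)) , Σ″ , M′ · ⌞ a ⌟ ⟫ ⇓ ⟪ (δ , D) , Σ‴ , ⌞ b ⌟ ⟫ →
      (e : Σ‴ ⊢ˢ b ∶ U) →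
      ⟪ C , Σ , box S M ⟫ ⇓ ⟪ C′ , Σ′ , circ S U (δ , structural⇒ b U e ∘ D) ⟫

    apply : ∀ {X S U Σ₁ Σ₂ Σ₃ Σ₃′ Σ₃″ Σ M N a b} {D : Circuit S U}
      {C₁ : Circuit X ⟨ Σ₁ ⟩} {C₂ : Circuit X ⟨ Σ₂ ⟩} {C₃ : Circuit X ⟨ Σ₃ ⟩} →
      ⟪ C₁ , Σ₁ , M ⟫ ⇓ ⟪ C₂ , Σ₂ , circ S U D ⟫ →
      ⟪ C₂ , Σ₂ , N ⟫ ⇓ ⟪ C₃ , Σ₃ , ⌞ a ⌟ ⟫ →
      (g : Gen Σ₃ U b Σ) →
      (p : Σ₃ ↭ Σ₃′ ++ Σ₃″) (d : Σ₃′ ⊢ˢ a ∶ S) →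
      ⟪ C₁ , Σ₁ , apply M N ⟫ ⇓
      ⟪ append {a = a} {b = b} C₃ p d D (Gen.typing g) , Σ ++ Σ₃″ , ⌞ b ⌟ ⟫

    reverse : ∀ {X S U Σ Σ′ M γ} {D : Mor γ S U}
      {C : Circuit X ⟨ Σ ⟩} {C′ : Circuit X ⟨ Σ′ ⟩} →
      ⟪ C , Σ , M ⟫ ⇓ ⟪ C′ , Σ′ , circ S U (γ , D) ⟫ →
      (γ>𝟎 : γ >𝟎) →
      ⟪ C , Σ , reverse M ⟫ ⇓ ⟪ C′ , Σ′ , circ U S (γ , dagger γ>𝟎 D) ⟫

    controlled : ∀ {X S Σ Σ′ M K} {D : Mor 𝟐 S S}
      {C : Circuit X ⟨ Σ ⟩} {C′ : Circuit X ⟨ Σ′ ⟩} →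
      ⟪ C , Σ , M ⟫ ⇓ ⟪ C′ , Σ′ , circ S S (𝟐 , D) ⟫ →
      ⟪ C , Σ , controlled K M ⟫ ⇓
      ⟪ C′ , Σ′ , circ (controlTy K ⊗ S) (controlTy K ⊗ S) (𝟐 , controlledMor K D) ⟫

    withComputed : ∀ {X S U Σ Σ′ Σ″ M N γ} {D₁ : Mor γ S U} {D₂ : Mor 𝟐 U U}
      {C : Circuit X ⟨ Σ ⟩} {C′ : Circuit X ⟨ Σ′ ⟩} {C″ : Circuit X ⟨ Σ″ ⟩} →
      ⟪ C , Σ , N ⟫ ⇓ ⟪ C′ , Σ′ , circ U U (𝟐 , D₂) ⟫ →
      ⟪ C′ , Σ′ , M ⟫ ⇓ ⟪ C″ , Σ″ , circ S U (γ , D₁) ⟫ →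
      (γ>𝟎 : γ >𝟎) →
      ⟪ C , Σ , withComputed M N ⟫ ⇓ ⟪ C″ , Σ″ , circ S S (𝟐 , conjugate (toR γ>𝟎 D₁) D₂) ⟫

  -- S ⊢[ α ] (C , Σ , M) : A ; Σ′. Label contexts being unordered, the equation
  -- Σ = (Σ″ , Σ′) is a permutation.
  infix 3 _⊢[_]_∶_⨾_

  _⊢[_]_∶_⨾_ : ∀ {n} (S : Simple) → Modality → Config S n → Type → LabelCtx → Set u
  S ⊢[ α ] ⟪ C , Σ , M ⟫ ∶ A ⨾ Σ′ =
    Distinct Σ ×
    ∃[ β ] ∃[ γ ] ∃[ Σ″ ]
      C ∈𝐃 β × Σ ↭ Σ″ ++ Σ′ × (∅ ∣ Σ″ ⊢[ γ ] M ∶ A) × α ≡ β ∧ γ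

{-# OPTIONS --safe #-}

-- Induction on the evaluation derivation. A subterm is evaluated while the
-- labels of its siblings are part of the configuration, so the induction
-- carries an arbitrary frame of labels F that the term does not use. A value
-- has modality 𝟐, the unit of ∧; the modality of the final circuit is therefore
-- exactly the meet of the initial one with the modality of the term.
--
-- A variable of parameter type may be used several times or not at all. This is
-- sound because a value of parameter type contains no labels.

module Submission where

open import Algebra.Bundles using (CommutativeMonoid)
open import Algebra.Properties.CommutativeSemigroup using (interchange)
open import Data.Empty using (⊥; ⊥-elim)
open import Data.Fin using (Fin; zero; suc)
open import Data.List using (List; []; _∷_; _++_; map)
open import Data.List.Membership.Propositional using (_∈_)
open import Data.List.Membership.Propositional.Properties using (∈-map⁺; ∈-++⁺ˡ; ∈-++⁺ʳ)
open import Data.List.Properties using (++-identityʳ; map-++)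
open import Data.List.Relation.Binary.Permutation.Propositional
  using (_↭_; ↭-refl; ↭-sym; ↭-trans; ↭-reflexive; ↭⇒↭ₛ)
open import Data.List.Relation.Binary.Permutation.Propositional.Properties
  using (↭-empty-inv; ++⁺; ++⁺ˡ; ++⁺ʳ; ++-assoc; ++-comm; shifts; drop-∷; ∈-resp-↭; map⁺; ++-commutativeMonoid)
import Data.List.Relation.Binary.Permutation.Setoid.Properties as Permutationₛ
import Data.List.Relation.Unary.All as ListAll
open import Data.List.Relation.Unary.AllPairs using ([]; _∷_)
open import Data.List.Relation.Unary.Any using (here; there)
open import Data.List.Relation.Unary.Unique.Propositional using (Unique)
import Data.List.Relation.Unary.Unique.Propositional.Properties as Unique
open import Data.Maybe using (Maybe; just; nothing)
import Data.Maybe.Relation.Unary.All as Maybe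
open import Data.Nat using (ℕ; zero; suc)
open import Data.Product using (∃-syntax; _×_; _,_; proj₁)
open import Data.Vec using ([]; _∷_)
open import Data.Vec.Relation.Unary.All using ([]; _∷_)
open import Relation.Binary.PropositionalEquality
  using (_≡_; refl; sym; trans; cong; cong₂; subst; setoid)
open import Defs

-- The commutative monoid of modalities under `_∧_`.

∧-assoc : ∀ α β γ → (α ∧ β) ∧ γ ≡ α ∧ β ∧ γ
∧-assoc 𝟎 β γ = refl
∧-assoc 𝟏 𝟎 γ = refl
∧-assoc 𝟏 𝟏 𝟎 = refl
∧-assoc 𝟏 𝟏 𝟏 = refl
∧-assoc 𝟏 𝟏 𝟐 = refl
∧-assoc 𝟏 𝟐 γ = refl
∧-assoc 𝟐 β γ = refl

∧-comm : ∀ α β → α ∧ β ≡ β ∧ α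
∧-comm 𝟎 𝟎 = refl
∧-comm 𝟎 𝟏 = refl
∧-comm 𝟎 𝟐 = refl
∧-comm 𝟏 𝟎 = refl
∧-comm 𝟏 𝟏 = refl
∧-comm 𝟏 𝟐 = refl
∧-comm 𝟐 𝟎 = refl
∧-comm 𝟐 𝟏 = refl
∧-comm 𝟐 𝟐 = refl

∧-identityʳ : ∀ α → α ∧ 𝟐 ≡ α
∧-identityʳ α = ∧-comm α 𝟐

-- Composes two successive evaluations, each of which meets the category of the circuit with the
-- modality of the term evaluated.
∧-step : ∀ α {β γ δ ε} → β ≡ α ∧ δ → γ ≡ β ∧ ε → γ ≡ α ∧ δ ∧ ε
∧-step α {δ = δ} {ε} eq eq′ = trans eq′ (trans (cong (_∧ ε) eq) (∧-assoc α δ ε))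

-- For `force`, `letpair` and `withComputed`, whose typing rules list the modalities in the order
-- opposite to evaluation.
∧-step-comm : ∀ α {β γ δ ε} → β ≡ α ∧ δ → γ ≡ β ∧ ε → γ ≡ α ∧ ε ∧ δ
∧-step-comm α {δ = δ} {ε} eq eq′ = trans (∧-step α {δ = δ} eq eq′) (cong (α ∧_) (∧-comm δ ε))

-- Lists up to permutation and lists without repetitions.

module _ {a} {A : Set a} where

  ++-interchange : (ws xs ys zs : List A) → (ws ++ xs) ++ (ys ++ zs) ↭ (ws ++ ys) ++ (xs ++ zs)
  ++-interchange = interchange (CommutativeMonoid.commutativeSemigroup (++-commutativeMonoid {A = A}))

  ++-cancelˡ : ∀ (xs : List A) {ys zs} → xs ++ ys ↭ xs ++ zs → ys ↭ zs
  ++-cancelˡ []       p = p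
  ++-cancelˡ (x ∷ xs) p = ++-cancelˡ xs (drop-∷ p)

  Unique-resp-↭ : ∀ {xs ys : List A} → xs ↭ ys → Unique xs → Unique ys
  Unique-resp-↭ p = Permutationₛ.Unique-resp-↭ (setoid A) (↭⇒↭ₛ p)

  Unique-++⁻ʳ : ∀ (xs : List A) {ys} → Unique (xs ++ ys) → Unique ys
  Unique-++⁻ʳ []       u       = u
  Unique-++⁻ʳ (x ∷ xs) (_ ∷ u) = Unique-++⁻ʳ xs u

  unique-keys : ∀ {b} {B : Set b} {xs : List (A × B)} {k v w} →
    Unique (map proj₁ xs) → (k , v) ∈ xs → (k , w) ∈ xs → v ≡ w
  unique-keys _        (here refl) (here refl) = refl
  unique-keys (k∉ ∷ _) (here refl) (there j)   = ⊥-elim (ListAll.lookup k∉ (∈-map⁺ proj₁ j) refl)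
  unique-keys (k∉ ∷ _) (there i)   (here refl) = ⊥-elim (ListAll.lookup k∉ (∈-map⁺ proj₁ i) refl)
  unique-keys (_ ∷ u)  (there i)   (there j)   = unique-keys u i j

module _ {u} {𝒦 : CircuitCategories u} (𝒮 : Signature 𝒦) where

  open Language 𝒮

  private
    variable
      m n   : ℕ
      α γ : Modality
      A B   : Type
      D     : Maybe Type
      Δ Δ₁ Δ₂ Δ′ : VarCtx n
      Σ Σ₁ Σ₂ Θ Θ₁ Θ₂ Ω F : LabelCtx
      M V V₁ V₂ : Tm n
      X     : Simple

  -- Variable contexts

  ∅-parameter : ∀ n → ParameterCtx (∅ {n})
  ∅-parameter zero    = []
  ∅-parameter (suc n) = Maybe.nothing ∷ ∅-parameter n

  ∅-⋈ : ∀ n → ∅ {n} ≔ ∅ ⋈ ∅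
  ∅-⋈ zero    = []
  ∅-⋈ (suc n) = absent (∅-⋈ n)

  -- Puts both premises of a binary typing rule back in `∅`, where the induction hypothesis of
  -- preservation applies.
  ∅-⋈-inv : ∅ {n} ≔ Δ₁ ⋈ Δ₂ → Δ₁ ≡ ∅ × Δ₂ ≡ ∅
  ∅-⋈-inv {zero}  []         = refl , refl
  ∅-⋈-inv {suc n} (absent s) with refl , refl ← ∅-⋈-inv s = refl , refl

  ∷-⋈ : Maybe.All Parameter D → Δ ≔ Δ₁ ⋈ Δ₂ → D ∷ Δ ≔ D ∷ Δ₁ ⋈ D ∷ Δ₂
  ∷-⋈ (Maybe.just P)  s = both P s
  ∷-⋈ Maybe.nothing   s = absent s

  -- Weakening

  -- Serves to push substituted terms under binders. The inserted entry is absent or of parameter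
  -- type, as only those may be discarded or duplicated.
  data Weakening : (Fin m → Fin n) → VarCtx m → VarCtx n → Set u where
    shift : Maybe.All Parameter D → Weakening suc Δ (D ∷ Δ)
    under : ∀ {ρ : Fin m → Fin n} → Weakening ρ Δ Δ′ → Weakening (liftRen ρ) (D ∷ Δ) (D ∷ Δ′)

  weaken-parameter : ∀ {ρ : Fin m → Fin n} → Weakening ρ Δ Δ′ → ParameterCtx Δ → ParameterCtx Δ′
  weaken-parameter (shift P) Φ       = P ∷ Φ
  weaken-parameter (under w) (P ∷ Φ) = P ∷ weaken-parameter w Φ

  weaken-∋ : ∀ {ρ : Fin m → Fin n} {x} → Weakening ρ Δ Δ′ → Δ ∋ x ∶ A → Δ′ ∋ ρ x ∶ A
  weaken-∋ (shift P) i           = there P i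
  weaken-∋ (under w) (here Φ)    = here (weaken-parameter w Φ)
  weaken-∋ (under w) (there P i) = there P (weaken-∋ w i)

  weaken-⋈ : ∀ {ρ : Fin m → Fin n} → Weakening ρ Δ Δ′ → Δ ≔ Δ₁ ⋈ Δ₂ →
    ∃[ Δ₁′ ] ∃[ Δ₂′ ] (Δ′ ≔ Δ₁′ ⋈ Δ₂′) × Weakening ρ Δ₁ Δ₁′ × Weakening ρ Δ₂ Δ₂′
  weaken-⋈ (shift P) s = _ , _ , ∷-⋈ P s , shift P , shift P
  weaken-⋈ (under w) (absent s) =
    let _ , _ , s′ , w₁ , w₂ = weaken-⋈ w s in _ , _ , absent s′ , under w₁ , under w₂
  weaken-⋈ (under w) (left s) =
    let _ , _ , s′ , w₁ , w₂ = weaken-⋈ w s in _ , _ , left s′ , under w₁ , under w₂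
  weaken-⋈ (under w) (right s) =
    let _ , _ , s′ , w₁ , w₂ = weaken-⋈ w s in _ , _ , right s′ , under w₁ , under w₂
  weaken-⋈ (under w) (both P s) =
    let _ , _ , s′ , w₁ , w₂ = weaken-⋈ w s in _ , _ , both P s′ , under w₁ , under w₂

  rename-⊢ : ∀ {ρ : Fin m → Fin n} → Weakening ρ Δ Δ′ → Δ ∣ Σ ⊢[ α ] M ∶ A → Δ′ ∣ Σ ⊢[ α ] rename ρ M ∶ A
  rename-⊢ w (var i)          = var (weaken-∋ w i)
  rename-⊢ w (lab Φ)          = lab (weaken-parameter w Φ)
  rename-⊢ w (unit Φ)         = unit (weaken-parameter w Φ)
  rename-⊢ w (const Φ)        = const (weaken-parameter w Φ)
  rename-⊢ w (lam d)          = lam (rename-⊢ (under w) d)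
  rename-⊢ w (app s p d e)    =
    let _ , _ , s′ , w₁ , w₂ = weaken-⋈ w s in app s′ p (rename-⊢ w₁ d) (rename-⊢ w₂ e)
  rename-⊢ w (lift Φ d)       = lift (weaken-parameter w Φ) (rename-⊢ w d)
  rename-⊢ w (force d)        = force (rename-⊢ w d)
  rename-⊢ w (pair s p d e)   =
    let _ , _ , s′ , w₁ , w₂ = weaken-⋈ w s in pair s′ p (rename-⊢ w₁ d) (rename-⊢ w₂ e)
  rename-⊢ w (letpair s p d e) =
    let _ , _ , s′ , w₁ , w₂ = weaken-⋈ w s in
    letpair s′ p (rename-⊢ (under (under w₁)) d) (rename-⊢ w₂ e)
  rename-⊢ w (circ Φ eq)      = circ (weaken-parameter w Φ) eq
  rename-⊢ w (apply s p d e)  =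
    let _ , _ , s′ , w₁ , w₂ = weaken-⋈ w s in apply s′ p (rename-⊢ w₁ d) (rename-⊢ w₂ e)
  rename-⊢ w (box d)          = box (rename-⊢ w d)
  rename-⊢ w (reverse d γ>𝟎)  = reverse (rename-⊢ w d) γ>𝟎
  rename-⊢ w (controlled d)   = controlled (rename-⊢ w d)
  rename-⊢ w (withComputed s p d γ>𝟎 e) =
    let _ , _ , s′ , w₁ , w₂ = weaken-⋈ w s in
    withComputed s′ p (rename-⊢ w₁ d) γ>𝟎 (rename-⊢ w₂ e)

  -- Substitution

  -- Closed values are substituted for the outer variables; the binders crossed
  -- on the way (under) keep theirs. Θ collects the labels of the values that
  -- are substituted for variables declared in the source.
  data Substitution : (Fin m → Tm n) → VarCtx m → VarCtx n → LabelCtx → Set u where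
    []    : ∀ {s : Fin 0 → Tm n} → Substitution s [] ∅ []
    skip  : ∀ {s : Fin (suc m) → Tm n} →
      Substitution (λ x → s (suc x)) Δ ∅ Θ → Substitution s (nothing ∷ Δ) ∅ Θ
    bind  : ∀ {s : Fin (suc m) → Tm n} →
      ∅ ∣ Θ₁ ⊢[ 𝟐 ] s zero ∶ A → (Parameter A → Θ₁ ≡ []) →
      Substitution (λ x → s (suc x)) Δ ∅ Θ₂ → Substitution s (just A ∷ Δ) ∅ (Θ₁ ++ Θ₂)
    under : ∀ {s : Fin m → Tm n} → Substitution s Δ Δ′ Θ → Substitution (liftSub s) (D ∷ Δ) (D ∷ Δ′) Θ

  -- An undeclared variable puts no condition on its image, so `s` is arbitrary.
  ∅-substitution : {s : Fin m → Tm n} → Substitution s ∅ ∅ []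
  ∅-substitution {zero}  = []
  ∅-substitution {suc m} = skip ∅-substitution

  -- Values of parameter type contain no labels, so rules that demand a parameter context acquire
  -- none under substitution.
  substitution-parameter : ∀ {s : Fin m → Tm n} → Substitution s Δ Δ′ Θ → ParameterCtx Δ →
    ParameterCtx Δ′ × Θ ≡ []
  substitution-parameter []       _       = ∅-parameter _ , refl
  substitution-parameter (skip σ) (_ ∷ Φ) = substitution-parameter σ Φ
  substitution-parameter (bind _ closed σ) (Maybe.just P ∷ Φ) =
    let Φ′ , eq = substitution-parameter σ Φ in Φ′ , cong₂ _++_ (closed P) eq
  substitution-parameter (under σ) (P ∷ Φ) =
    let Φ′ , eq = substitution-parameter σ Φ in P ∷ Φ′ , eq

  substitution-∋ : ∀ {s : Fin m → Tm n} {x} → Substitution s Δ Δ′ Θ → Δ ∋ x ∶ A →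
    Δ′ ∣ Θ ⊢[ 𝟐 ] s x ∶ A
  substitution-∋ (skip σ) (there _ i) = substitution-∋ σ i
  substitution-∋ (bind {Θ₁ = Θ₁} d closed σ) (here Φ)
    -- The other declared variables are parameters, whose values contribute no labels, so only `Θ₁`
    -- remains.
    with _ , refl ← substitution-parameter σ Φ rewrite ++-identityʳ Θ₁ = d
  substitution-∋ (bind d closed σ) (there (Maybe.just P) i)
    with refl ← closed P = substitution-∋ σ i
  substitution-∋ (under σ) (here Φ)
    with Φ′ , refl ← substitution-parameter σ Φ = var (here Φ′)
  substitution-∋ (under σ) (there P i) = rename-⊢ (shift P) (substitution-∋ σ i)

  SplitSubstitution : (Fin m → Tm n) → VarCtx m → VarCtx m → VarCtx n → LabelCtx → Set u
  SplitSubstitution s Δ₁ Δ₂ Δ′ Θ =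
    ∃[ Δ₁′ ] ∃[ Δ₂′ ] ∃[ Θ₁ ] ∃[ Θ₂ ]
      (Δ′ ≔ Δ₁′ ⋈ Δ₂′) × Θ ↭ Θ₁ ++ Θ₂ × Substitution s Δ₁ Δ₁′ Θ₁ × Substitution s Δ₂ Δ₂′ Θ₂

  -- `skip` and `bind` only build substitutions into `∅`, so the halves of the target must be
  -- identified with `∅` before a variable can be added.
  split-∅ : ∀ {s : Fin m → Tm n} → SplitSubstitution s Δ₁ Δ₂ ∅ Θ →
    ∃[ Θ₁ ] ∃[ Θ₂ ] Θ ↭ Θ₁ ++ Θ₂ × Substitution s Δ₁ ∅ Θ₁ × Substitution s Δ₂ ∅ Θ₂
  split-∅ (_ , _ , Θ₁ , Θ₂ , s , p , σ₁ , σ₂) with refl , refl ← ∅-⋈-inv s = Θ₁ , Θ₂ , p , σ₁ , σ₂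

  -- The labels of a value follow its variable into one half. A parameter variable goes into both,
  -- and its value has no labels to duplicate.
  substitution-⋈ : ∀ {s : Fin m → Tm n} → Substitution s Δ Δ′ Θ → Δ ≔ Δ₁ ⋈ Δ₂ →
    SplitSubstitution s Δ₁ Δ₂ Δ′ Θ
  substitution-⋈ [] [] = _ , _ , [] , [] , ∅-⋈ _ , ↭-refl , [] , []
  substitution-⋈ (skip σ) (absent s) =
    let _ , _ , p , σ₁ , σ₂ = split-∅ (substitution-⋈ σ s) in
    _ , _ , _ , _ , ∅-⋈ _ , p , skip σ₁ , skip σ₂
  substitution-⋈ (bind {Θ₁ = Θ} d closed σ) (left s) =
    let Θ₁ , Θ₂ , p , σ₁ , σ₂ = split-∅ (substitution-⋈ σ s) in
    _ , _ , _ , _ , ∅-⋈ _ , ↭-trans (++⁺ˡ Θ p) (↭-sym (++-assoc Θ Θ₁ Θ₂)) , bind d closed σ₁ , skip σ₂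
  substitution-⋈ (bind {Θ₁ = Θ} d closed σ) (right s) =
    let Θ₁ , Θ₂ , p , σ₁ , σ₂ = split-∅ (substitution-⋈ σ s) in
    _ , _ , _ , _ , ∅-⋈ _ , ↭-trans (++⁺ˡ Θ p) (shifts Θ Θ₁) , skip σ₁ , bind d closed σ₂
  substitution-⋈ (bind d closed σ) (both P s) with refl ← closed P =
    let _ , _ , p , σ₁ , σ₂ = split-∅ (substitution-⋈ σ s) in
    _ , _ , _ , _ , ∅-⋈ _ , p , bind d closed σ₁ , bind d closed σ₂
  substitution-⋈ (under σ) (absent s) =
    let _ , _ , _ , _ , s′ , p , σ₁ , σ₂ = substitution-⋈ σ s in
    _ , _ , _ , _ , absent s′ , p , under σ₁ , under σ₂
  substitution-⋈ (under σ) (left s) =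
    let _ , _ , _ , _ , s′ , p , σ₁ , σ₂ = substitution-⋈ σ s in
    _ , _ , _ , _ , left s′ , p , under σ₁ , under σ₂
  substitution-⋈ (under σ) (right s) =
    let _ , _ , _ , _ , s′ , p , σ₁ , σ₂ = substitution-⋈ σ s in
    _ , _ , _ , _ , right s′ , p , under σ₁ , under σ₂
  substitution-⋈ (under σ) (both P s) =
    let _ , _ , _ , _ , s′ , p , σ₁ , σ₂ = substitution-⋈ σ s in
    _ , _ , _ , _ , both P s′ , p , under σ₁ , under σ₂

  ++-regroup : ∀ Σ₁ {Σ₂} Θ₁ {Θ₂} → Σ ↭ Σ₁ ++ Σ₂ → Θ ↭ Θ₁ ++ Θ₂ →
    Σ ++ Θ ↭ (Σ₁ ++ Θ₁) ++ (Σ₂ ++ Θ₂)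
  ++-regroup Σ₁ {Σ₂} Θ₁ {Θ₂} p q = ↭-trans (++⁺ p q) (++-interchange Σ₁ Σ₂ Θ₁ Θ₂)

  -- The modality is unchanged because variables and the values put in their place both have
  -- modality `𝟐`.
  substitute-⊢ : ∀ {s : Fin m → Tm n} → Substitution s Δ Δ′ Θ → Δ ∣ Σ ⊢[ α ] M ∶ A →
    Δ′ ∣ Σ ++ Θ ⊢[ α ] substitute s M ∶ A
  substitute-⊢ σ (var i) = substitution-∋ σ i
  substitute-⊢ σ (lab Φ)   with Φ′ , refl ← substitution-parameter σ Φ = lab Φ′
  substitute-⊢ σ (unit Φ)  with Φ′ , refl ← substitution-parameter σ Φ = unit Φ′
  substitute-⊢ σ (const Φ) with Φ′ , refl ← substitution-parameter σ Φ = const Φ′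
  substitute-⊢ σ (lam d) = lam (substitute-⊢ (under σ) d)
  substitute-⊢ σ (app {Σ₁ = Σ₁} s p d e) =
    let _ , _ , Θ₁ , _ , s′ , q , σ₁ , σ₂ = substitution-⋈ σ s in
    app s′ (++-regroup Σ₁ Θ₁ p q) (substitute-⊢ σ₁ d) (substitute-⊢ σ₂ e)
  substitute-⊢ σ (lift Φ d) with Φ′ , refl ← substitution-parameter σ Φ = lift Φ′ (substitute-⊢ σ d)
  substitute-⊢ σ (force d) = force (substitute-⊢ σ d)
  substitute-⊢ σ (pair {Σ₁ = Σ₁} s p d e) =
    let _ , _ , Θ₁ , _ , s′ , q , σ₁ , σ₂ = substitution-⋈ σ s in
    pair s′ (++-regroup Σ₁ Θ₁ p q) (substitute-⊢ σ₁ d) (substitute-⊢ σ₂ e)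
  substitute-⊢ σ (letpair {Σ₁ = Σ₁} s p d e) =
    let _ , _ , Θ₁ , _ , s′ , q , σ₁ , σ₂ = substitution-⋈ σ s in
    letpair s′ (++-regroup Σ₁ Θ₁ p q) (substitute-⊢ (under (under σ₁)) d) (substitute-⊢ σ₂ e)
  substitute-⊢ σ (circ Φ eq) with Φ′ , refl ← substitution-parameter σ Φ = circ Φ′ eq
  substitute-⊢ σ (apply {Σ₁ = Σ₁} s p d e) =
    let _ , _ , Θ₁ , _ , s′ , q , σ₁ , σ₂ = substitution-⋈ σ s in
    apply s′ (++-regroup Σ₁ Θ₁ p q) (substitute-⊢ σ₁ d) (substitute-⊢ σ₂ e)
  substitute-⊢ σ (box d) = box (substitute-⊢ σ d)
  substitute-⊢ σ (reverse d γ>𝟎) = reverse (substitute-⊢ σ d) γ>𝟎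
  substitute-⊢ σ (controlled d) = controlled (substitute-⊢ σ d)
  substitute-⊢ σ (withComputed {Σ₁ = Σ₁} s p d γ>𝟎 e) =
    let _ , _ , Θ₁ , _ , s′ , q , σ₁ , σ₂ = substitution-⋈ σ s in
    withComputed s′ (++-regroup Σ₁ Θ₁ p q) (substitute-⊢ σ₁ d) γ>𝟎 (substitute-⊢ σ₂ e)

  -- Values and simple terms

  value-modality : Value V → Δ ∣ Σ ⊢[ α ] V ∶ A → α ≡ 𝟐
  value-modality (const c)    (const _)  = refl
  value-modality (var x)      (var _)    = refl
  value-modality (lab ℓ)      (lab _)    = refl
  value-modality unit         (unit _)   = refl
  value-modality (ƛ M)        (lam _)    = refl
  value-modality (pair v w)   (pair _ _ d e) = cong₂ _∧_ (value-modality v d) (value-modality w e)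
  value-modality (lift M)     (lift _ _) = refl
  value-modality (circ S U C) (circ _ _) = refl

  -- Labels and abstractions do not have parameter types, lifted terms and circuits are typed
  -- without labels, and pairs follow by induction.
  parameter-value-labels : Value V → Δ ∣ Σ ⊢[ α ] V ∶ A → Parameter A → Σ ≡ []
  parameter-value-labels (const c)    (const _)  _ = refl
  parameter-value-labels (var x)      (var _)    _ = refl
  parameter-value-labels (lab ℓ)      (lab _)    ()
  parameter-value-labels unit         (unit _)   _ = refl
  parameter-value-labels (ƛ M)        (lam _)    ()
  parameter-value-labels (pair v w)   (pair _ p d e) (P ⊗ Q)
    with refl ← parameter-value-labels v d P | refl ← parameter-value-labels w e Q = ↭-empty-inv p
  parameter-value-labels (lift M)     (lift _ _) _ = refl
  parameter-value-labels (circ S U C) (circ _ _) _ = refl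

  simple-value : ∀ a → Value {n} ⌞ a ⌟
  simple-value (lab ℓ)    = lab ℓ
  simple-value unit       = unit
  simple-value (pair a b) = pair (simple-value a) (simple-value b)

  ⇓-value : ∀ {c c′ : Config X n} → c ⇓ c′ → Value (Config.term c′)
  ⇓-value (value v)            = v
  ⇓-value (app _ _ e)          = ⇓-value e
  ⇓-value (force _ e)          = ⇓-value e
  ⇓-value (letpair _ e)        = ⇓-value e
  ⇓-value (pair e e′)          = pair (⇓-value e) (⇓-value e′)
  ⇓-value (box _ _ _ _)        = circ _ _ _
  ⇓-value (apply {b = b} _ _ _ _ _) = simple-value b
  ⇓-value (reverse _ _)        = circ _ _ _
  ⇓-value (controlled _)       = circ _ _ _
  ⇓-value (withComputed _ _ _) = circ _ _ _

  bind-value : ∀ {s : Fin (suc m) → Tm n} → Value (s zero) → ∅ ∣ Θ₁ ⊢[ 𝟐 ] s zero ∶ A →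
    Substitution (λ x → s (suc x)) Δ ∅ Θ₂ → Substitution s (just A ∷ Δ) ∅ (Θ₁ ++ Θ₂)
  bind-value v d = bind d (parameter-value-labels v d)

  -- Moves a simple term between scopes: generated terms are typed in the empty scope, terms of a
  -- configuration in scope `n`.
  simple-⊢ : ∀ a S → Δ ∣ Σ ⊢[ α ] ⌞ a ⌟ ∶ ⌜ S ⌝ → ∅ {n} ∣ Σ ⊢[ 𝟐 ] ⌞ a ⌟ ∶ ⌜ S ⌝
  simple-⊢ (lab ℓ)    (wire W) (lab _)        = lab (∅-parameter _)
  simple-⊢ unit       unit     (unit _)       = unit (∅-parameter _)
  simple-⊢ (pair a b) (S ⊗ U)  (pair _ p d e) = pair (∅-⋈ _) p (simple-⊢ a S d) (simple-⊢ b U e)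

  -- Each occurrence of a label consumes exactly that label, at the wire type prescribed by `S`.
  simple-labels : ∀ {Δ : VarCtx m} {Δ′ : VarCtx n} a S →
    Δ ∣ Σ ⊢[ α ] ⌞ a ⌟ ∶ ⌜ S ⌝ → Δ′ ∣ Σ₁ ⊢[ γ ] ⌞ a ⌟ ∶ ⌜ S ⌝ → Σ ↭ Σ₁
  simple-labels (lab ℓ)    (wire W) (lab _)  (lab _)  = ↭-refl
  simple-labels unit       unit     (unit _) (unit _) = ↭-refl
  simple-labels (pair a b) (S ⊗ U)  (pair _ p d e) (pair _ p′ d′ e′) =
    ↭-trans p (↭-trans (++⁺ (simple-labels a S d d′) (simple-labels b U e e′)) (↭-sym p′))

  -- The term alone does not determine its type, since a label may be declared with any wire type.
  -- Inclusion in a common context with distinct labels settles it.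
  simple-unique : ∀ {Δ : VarCtx m} {Δ′ : VarCtx n} a S U →
    Distinct Ω → (∀ {x} → x ∈ Σ → x ∈ Ω) → (∀ {x} → x ∈ Σ₁ → x ∈ Ω) →
    Δ ∣ Σ ⊢[ α ] ⌞ a ⌟ ∶ ⌜ S ⌝ → Δ′ ∣ Σ₁ ⊢[ γ ] ⌞ a ⌟ ∶ ⌜ U ⌝ → S ≡ U
  simple-unique (lab ℓ) (wire W) (wire W′) u i j (lab _) (lab _) =
    cong wire (unique-keys u (i (here refl)) (j (here refl)))
  simple-unique unit unit unit _ _ _ (unit _) (unit _) = refl
  simple-unique (pair a b) (S ⊗ S′) (U ⊗ U′) u i j
    (pair {Σ₁ = Σ₁} _ p d e) (pair {Σ₁ = Σ₁′} _ p′ d′ e′) = cong₂ _⊗_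
      (simple-unique a S U u (λ x → i (∈-resp-↭ (↭-sym p) (∈-++⁺ˡ x)))
        (λ x → j (∈-resp-↭ (↭-sym p′) (∈-++⁺ˡ x))) d d′)
      (simple-unique b S′ U′ u (λ x → i (∈-resp-↭ (↭-sym p) (∈-++⁺ʳ Σ₁ x)))
        (λ x → j (∈-resp-↭ (↭-sym p′) (∈-++⁺ʳ Σ₁′ x))) e e′)

  -- The survivors `Θ₂` are part of `Ω`, hence distinct among themselves and from the fresh labels
  -- that replace `Θ₁`.
  append-distinct : Distinct Σ₁ → (∀ {ℓ} → ℓ ∈ labels Σ₁ × ℓ ∈ labels Ω → ⊥) →
    Distinct Ω → Ω ↭ Θ₁ ++ Θ₂ → Distinct (Σ₁ ++ Θ₂)
  append-distinct {Σ₁ = Σ₁} {Ω} {Θ₁} {Θ₂} u₁ fresh u p =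
    subst Unique (sym (map-++ proj₁ Σ₁ Θ₂))
      (Unique.++⁺ u₁ (Unique-++⁻ʳ (labels Θ₁) (Unique-resp-↭ q u))
        (λ (i , j) → fresh (i , ∈-resp-↭ (↭-sym q) (∈-++⁺ʳ (labels Θ₁) j))))
    where
    q : labels Ω ↭ labels Θ₁ ++ labels Θ₂
    q = ↭-trans (map⁺ proj₁ p) (↭-reflexive (map-++ proj₁ Θ₁ Θ₂))

  -- Preservation

  -- The typing modality is fixed to `𝟐`, that of values, so `α` is the category of the circuit
  -- alone. Evaluation may change `used`, but not the frame `F`.
  record Evaluated (c : Config X n) (α : Modality) (A : Type) (F : LabelCtx) : Set u where
    constructor evaluated
    field
      {used}   : LabelCtx
      distinct : Distinct (Config.labelCtx c)
      framed   : Config.labelCtx c ↭ used ++ F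
      typing   : ∅ ∣ used ⊢[ 𝟐 ] Config.term c ∶ A
      category : proj₁ (Config.circuit c) ≡ α

  frame-left : ∀ Θ₁ {Θ₂} → Σ ↭ Θ ++ F → Θ ↭ Θ₁ ++ Θ₂ → Σ ↭ Θ₁ ++ (Θ₂ ++ F)
  frame-left {F = F} Θ₁ {Θ₂} p q = ↭-trans p (↭-trans (++⁺ʳ F q) (++-assoc Θ₁ Θ₂ F))

  frame-swap : ∀ Θ₁ Θ₂ → Σ ↭ Θ₁ ++ (Θ₂ ++ F) → Σ ↭ Θ₂ ++ (Θ₁ ++ F)
  frame-swap Θ₁ Θ₂ p = ↭-trans p (shifts Θ₁ Θ₂)

  frame-right : ∀ Θ₁ Θ₂ → Σ ↭ Θ ++ F → Θ ↭ Θ₁ ++ Θ₂ → Σ ↭ Θ₂ ++ (Θ₁ ++ F)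
  frame-right Θ₁ Θ₂ p q = frame-swap Θ₁ Θ₂ (frame-left Θ₁ p q)

  frame-join : ∀ Θ₁ Θ₂ → Σ ↭ Θ₁ ++ (Θ₂ ++ F) → Σ ↭ (Θ₁ ++ Θ₂) ++ F
  frame-join {F = F} Θ₁ Θ₂ p = ↭-trans p (↭-sym (++-assoc Θ₁ Θ₂ F))

  pair-inv : Value V₁ → Value V₂ → ∅ ∣ Σ ⊢[ α ] pair V₁ V₂ ∶ A ⊗ B →
    ∃[ Σ₁ ] ∃[ Σ₂ ] Σ ↭ Σ₁ ++ Σ₂ × (∅ ∣ Σ₁ ⊢[ 𝟐 ] V₁ ∶ A) × (∅ ∣ Σ₂ ⊢[ 𝟐 ] V₂ ∶ B)
  pair-inv v w (pair s p d e)
    with refl , refl ← ∅-⋈-inv s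
    with refl ← value-modality v d | refl ← value-modality w e = _ , _ , p , d , e

  value-pair-inv : Value (pair V₁ V₂) → Value V₁ × Value V₂
  value-pair-inv (pair v w) = v , w

  preservation : ∀ {c c′ : Config X n} → c ⇓ c′ → Distinct (Config.labelCtx c) →
    Config.labelCtx c ↭ Θ ++ F → ∅ ∣ Θ ⊢[ γ ] Config.term c ∶ A →
    Evaluated c′ (proj₁ (Config.circuit c) ∧ γ) A F
  preservation (value v) u p d with refl ← value-modality v d =
    evaluated u p d (sym (∧-identityʳ _))
  preservation {F = F} (app {C₁ = C₁} {C₂} e₁ e₂ e₃) u p (app {Σ₁ = Θ₁} {Θ₂} s q d₁ d₂)
    with refl , refl ← ∅-⋈-inv s
    -- The labels `Θ₂` of the argument are framed while the function is evaluated, then the labels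
    -- `Ξ₁` of the abstraction while the argument is.
    with evaluated {Ξ₁} u₁ p₁ (lam b) c₁ ← preservation {F = Θ₂ ++ F} e₁ u (frame-left Θ₁ p q) d₁
    with evaluated {Ξ₂} u₂ p₂ d c₂ ← preservation {F = Ξ₁ ++ F} e₂ u₁ (frame-swap Ξ₁ Θ₂ p₁) d₂
    with evaluated u₃ p₃ d′ c₃ ← preservation {F = F} e₃ u₂
           -- Substitution types the body with labels `Ξ₁ ++ (Ξ₂ ++ [])`, the final `[]` coming from
           -- `∅-substitution`.
           (↭-trans (frame-join Ξ₁ Ξ₂ (frame-swap Ξ₂ Ξ₁ p₂))
             (++⁺ʳ F (++⁺ˡ Ξ₁ (↭-reflexive (sym (++-identityʳ Ξ₂))))))
           (substitute-⊢ (bind-value (⇓-value e₂) d ∅-substitution) b)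
    = evaluated u₃ p₃ d′ (∧-step (proj₁ C₁) c₁ (∧-step (proj₁ C₂) c₂ c₃))
  preservation {F = F} (force {C = C} e₁ e₂) u p (force d)
    with evaluated u₁ p₁ (lift _ b) c₁ ← preservation {F = F} e₁ u p d
    with evaluated u₂ p₂ d′ c₂ ← preservation {F = F} e₂ u₁ p₁ b
    = evaluated u₂ p₂ d′ (∧-step-comm (proj₁ C) c₁ c₂)
  preservation {F = F} (letpair {C = C} e₁ e₂) u p (letpair {Σ₁ = Θ₁} {Θ₂} s q b d)
    with refl , refl ← ∅-⋈-inv s
    with v , w ← value-pair-inv (⇓-value e₁)
    with evaluated {Ξ} u₁ p₁ dV c₁ ← preservation {F = Θ₁ ++ F} e₁ u (frame-right Θ₁ Θ₂ p q) d
    with Ξ₁ , Ξ₂ , r , d₁ , d₂ ← pair-inv v w dV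
    with evaluated u₂ p₂ d′ c₂ ← preservation {F = F} e₂ u₁
           (↭-trans (frame-join Θ₁ Ξ (frame-swap Ξ Θ₁ p₁))
             -- Index 0 is bound to the second component, so its labels `Ξ₂` come first.
             (++⁺ʳ F (++⁺ˡ Θ₁ (↭-trans r (↭-trans (++-comm Ξ₁ Ξ₂)
               (++⁺ˡ Ξ₂ (↭-reflexive (sym (++-identityʳ Ξ₁)))))))))
           (substitute-⊢ (bind-value w d₂ (bind-value v d₁ ∅-substitution)) b)
    = evaluated u₂ p₂ d′ (∧-step-comm (proj₁ C) c₁ c₂)
  preservation {F = F} (pair {C = C} e₁ e₂) u p (pair {Σ₁ = Θ₁} {Θ₂} s q d₁ d₂)
    with refl , refl ← ∅-⋈-inv s
    with evaluated {Ξ₁} u₁ p₁ d₁′ c₁ ← preservation {F = Θ₂ ++ F} e₁ u (frame-left Θ₁ p q) d₁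
    with evaluated {Ξ₂} u₂ p₂ d₂′ c₂ ← preservation {F = Ξ₁ ++ F} e₂ u₁ (frame-swap Ξ₁ Θ₂ p₁) d₂
    = evaluated u₂ (frame-join Ξ₁ Ξ₂ (frame-swap Ξ₂ Ξ₁ p₂)) (pair (∅-⋈ _) ↭-refl d₁′ d₂′) (∧-step (proj₁ C) c₁ c₂)
  preservation {F = F} (box {S = S} {a = a} {b = b} e₁ g e₂ t) u p (box {U = U} d)
    with evaluated u₁ p₁ (lift _ f) c₁ ← preservation {F = F} e₁ u p d
    -- The boxed function runs with the generated labels only, hence the empty frame. Its circuit
    -- starts in `𝐍` and `𝟐` is the unit of `_∧_`, so `c₂` is exactly the modality required of the
    -- boxed circuit.
    with evaluated u₂ p₂ dᵇ c₂ ← preservation {F = []} e₂ (Gen.distinct g)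
           (↭-reflexive (sym (++-identityʳ _)))
           (app (∅-⋈ _) ↭-refl f (simple-⊢ a S (Gen.typing g)))
    -- Evaluation reads the codomain off `b` while the typing prescribes `U`; distinctness of the
    -- final labels makes them agree.
    with refl ← simple-unique b _ U u₂ (λ i → i) (λ i → ∈-resp-↭ (↭-sym p₂) (∈-++⁺ˡ i)) t dᵇ
    = evaluated u₁ p₁ (circ (∅-parameter _) c₂) c₁
  preservation {F = F} (apply {S = S} {U = U} {Σ₃′ = Σ₃′} {Σ = Σ} {a = a} {b = b} {C₁ = C₁} {C₂} e₁ e₂ g r t) u p
    (apply {Σ₁ = Θ₁} {Θ₂} s q d₁ d₂)
    with refl , refl ← ∅-⋈-inv s
    -- A circuit uses no labels, so exactly `Θ₂ ++ F` remains for evaluating the argument.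
    with evaluated u₁ p₁ (circ _ refl) c₁ ← preservation {F = Θ₂ ++ F} e₁ u (frame-left Θ₁ p q) d₁
    with evaluated {Ξ} u₂ p₂ dᵃ c₂ ← preservation {F = F} e₂ u₁ p₁ d₂
    = evaluated
        (append-distinct (Gen.distinct g) (Gen.fresh g) u₂ r)
        -- `Σ₃′` is a permutation of the labels `Ξ` of the argument; cancelling it identifies the
        -- untouched labels `Σ₃″` with the frame.
        (++⁺ˡ Σ (++-cancelˡ Σ₃′ (↭-trans (↭-sym r) (↭-trans p₂ (++⁺ʳ F (simple-labels a S dᵃ t))))))
        (simple-⊢ b U (Gen.typing g))
        (∧-step (proj₁ C₁) c₁ (∧-step (proj₁ C₂) c₂ refl))
  preservation (reverse e _) u p (reverse d _)
    with evaluated u₁ p₁ (circ Φ refl) c ← preservation e u p d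
    -- The dagger is taken in the category of the circuit, so the modality is kept.
    = evaluated u₁ p₁ (circ Φ refl) c
  preservation (controlled e) u p (controlled d)
    with evaluated u₁ p₁ (circ Φ refl) c ← preservation e u p d
    = evaluated u₁ p₁ (circ Φ refl) c
  preservation {F = F} (withComputed {C = C} e₁ e₂ _) u p (withComputed {Σ₁ = Θ₁} {Θ₂} s q d₁ _ d₂)
    with refl , refl ← ∅-⋈-inv s
    with evaluated u₁ p₁ (circ _ refl) c₁ ← preservation {F = Θ₁ ++ F} e₁ u (frame-right Θ₁ Θ₂ p q) d₂
    with evaluated u₂ p₂ (circ Φ refl) c₂ ← preservation {F = F} e₂ u₁ p₁ d₁
    -- `_•_` lands in `𝐍`, so the new circuit has modality `𝟐` whatever the category of the
    -- conjugating circuit.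
    = evaluated u₂ p₂ (circ Φ refl) (∧-step-comm (proj₁ C) c₁ c₂)

mainTheorem1 : ∀ {u} {𝒦 : CircuitCategories u} (𝒮 : Signature 𝒦) → let open Language 𝒮 in
    ∀ {n : ℕ} (S : Simple) (α : Modality) (M V : Tm n) (A : Type)
    (Σ₁ Σ₂ Σ′ : LabelCtx) (C₁ : Circuit S ⟨ Σ₁ ⟩) (C₂ : Circuit S ⟨ Σ₂ ⟩) →
    Value V →
    S ⊢[ α ] ⟪ C₁ , Σ₁ , M ⟫ ∶ A ⨾ Σ′ →
    ⟪ C₁ , Σ₁ , M ⟫ ⇓ ⟪ C₂ , Σ₂ , V ⟫ →
    S ⊢[ α ] ⟪ C₂ , Σ₂ , V ⟫ ∶ A ⨾ Σ′
mainTheorem1 𝒮 S α M V A Σ₁ Σ₂ Σ′ C₁ C₂ _ (u , β , γ , Σ″ , refl , p , d , refl) e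
  -- The labels `Σ′` left over by the typing serve as the frame.
  with evaluated u₂ p₂ d₂ refl ← preservation 𝒮 {F = Σ′} e u p d =
  u₂ , _ , _ , _ , refl , p₂ , d₂ , sym (∧-identityʳ _)
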